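{- For every $G\in\mathcal{M}(\mathcal{C})$ there exist an integer $n\geq 0$ and a sequence of graphs $G_0,G_1,\ldots,G_n$, each in $\mathcal{M}(\mathcal{C})$, such that $G_0\in\{K_5-e,\;K_4\vee K_4\}$, $G_n=G$, and $G_{k-1}$ is a minor of $G_k$ for every $k\in\{1,\ldots,n\}$. In fact, for every $k\in\{1,\ldots,n\}$ one can take $G_{k-1}$ to be an arbitrary graph in $\mathcal{M}(\mathcal{C})$ that is a subgraph of the graph $G_k/f$ obtained from $G_k$ by contracting an arbitrary edge $f$ of $G_k$ that belongs to at most one triangle of $G_k$ (and $G_k/f\in\mathcal{R}(\mathcal{C})$ for such $f$).
   Context: All graphs are finite and simple; contraction of an edge produces a simple graph (parallel edges merged, no loops). $\mathcal{C}$ is the property of containing a cycle. $\mathcal{R}(\mathcal{C})$ is the class of graphs $G$ such that every $2$-colouring of the edges of $G$ admits a monochromatic cycle (of any length). $\mathcal{M}(\mathcal{C})$ is the class of graphs in $\mathcal{R}(\mathcal{C})$ no proper subgraph of which is in $\mathcal{R}(\mathcal{C})$. $K_5-e$ is the complete graph on $5$ vertices with one edge removed, and $K_4\vee K_4$ is the graph obtained from two disjoint copies of $K_4$ by identifying an edge of one with an edge of the other (6 vertices, 11 edges). -}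

module Defs where

open import Data.Nat using (ℕ; zero; suc; _+_)
open import Data.Fin using (#_; Fin; zero; suc; punchOut; inject₁; fromℕ; _≟_)
import Data.Fin.Properties as FinP
open import Data.Bool using (Bool; true; false)
open import Data.List using (List; []; _∷_)
open import Data.List.Relation.Unary.Any using (Any)
import Data.List.Relation.Unary.Any as Any
open import Data.Product using (Σ; ∃; _×_; _,_; proj₁; proj₂)
open import Data.Sum using (_⊎_; inj₁; inj₂)
open import Data.Empty using (⊥)
open import Relation.Nullary using (¬_; Dec; yes; no)
open import Relation.Nullary.Decidable using (_×-dec_; _⊎-dec_; ¬?)
open import Relation.Binary.PropositionalEquality using (_≡_; _≢_; refl; sym; subst)
open import Function.Definitions using (Injective)

record Graph : Set₁ where
  field
    n      : ℕ
    Adj    : Fin n → Fin n → Set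
    adj?   : ∀ i j → Dec (Adj i j)
    adj-sym : ∀ {i j} → Adj i j → Adj j i
    irrefl : ∀ {i} → ¬ Adj i i

open Graph public

fromEdges : (n : ℕ) → List (Fin n × Fin n) → Graph
fromEdges n es = record
  { n = n
  ; Adj = A
  ; adj? = λ i j → ¬? (i ≟ j) ×-dec (Any.any? (λ p → (proj₁ p ≟ i) ×-dec (proj₂ p ≟ j)) es
                                    ⊎-dec Any.any? (λ p → (proj₁ p ≟ j) ×-dec (proj₂ p ≟ i)) es)
  ; adj-sym = λ { (ne , inj₁ x) → (λ e → ne (sym e)) , inj₂ x
            ; (ne , inj₂ x) → (λ e → ne (sym e)) , inj₁ x }
  ; irrefl = λ { (ne , _) → ne refl }
  }
  where
  A : Fin n → Fin n → Set
  A i j = i ≢ j × (Any (λ p → proj₁ p ≡ i × proj₂ p ≡ j) es ⊎ Any (λ p → proj₁ p ≡ j × proj₂ p ≡ i) es)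

K5-e : Graph
K5-e = fromEdges 5
  ( (# 0 , # 2) ∷ (# 0 , # 3) ∷ (# 0 , # 4) ∷ (# 1 , # 2) ∷ (# 1 , # 3) ∷ (# 1 , # 4)
  ∷ (# 2 , # 3) ∷ (# 2 , # 4) ∷ (# 3 , # 4) ∷ [])

-- K₄ ∨ K₄ : two K₄'s {0,1,2,3} and {0,1,4,5} sharing the edge {0,1}.
K4∨K4 : Graph
K4∨K4 = fromEdges 6
  ( (# 0 , # 1) ∷ (# 0 , # 2) ∷ (# 0 , # 3) ∷ (# 1 , # 2) ∷ (# 1 , # 3) ∷ (# 2 , # 3)
  ∷ (# 0 , # 4) ∷ (# 0 , # 5) ∷ (# 1 , # 4) ∷ (# 1 , # 5) ∷ (# 4 , # 5) ∷ [])

record _≅_ (G H : Graph) : Set where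
  field
    to      : Fin (n G) → Fin (n H)
    from    : Fin (n H) → Fin (n G)
    from∘to : ∀ i → from (to i) ≡ i
    to∘from : ∀ j → to (from j) ≡ j
    pres    : ∀ {i j} → Adj G i j → Adj H (to i) (to j)
    refl'   : ∀ {i j} → Adj H (to i) (to j) → Adj G i j

record _⊆_ (H G : Graph) : Set where
  field
    emb  : Fin (n H) → Fin (n G)
    inj  : Injective _≡_ _≡_ emb
    pres : ∀ {a b} → Adj H a b → Adj G (emb a) (emb b)

record ProperSubgraph (H G : Graph) : Set where
  field
    sub    : H ⊆ G
    proper : (∃ λ (x : Fin (n G)) → ∀ a → _⊆_.emb sub a ≢ x)
           ⊎ (∃ λ (x : Fin (n G)) → ∃ λ (y : Fin (n G)) → Adj G x y ×
                ¬ (∃ λ a → ∃ λ b → _⊆_.emb sub a ≡ x × _⊆_.emb sub b ≡ y × Adj H a b))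

-- A 2-colouring of the edges: a symmetric function on pairs of vertices
-- (only its values on edges matter).
record Colouring (G : Graph) : Set where
  field
    col : Fin (n G) → Fin (n G) → Bool
    col-sym : ∀ i j → col i j ≡ col j i

record MonoCycle (G : Graph) (κ : Colouring G) : Set where
  open Colouring κ
  field
    m     : ℕ
    v     : Fin (3 + m) → Fin (n G)
    v-inj : Injective _≡_ _≡_ v
    c     : Bool
    step  : ∀ (i : Fin (2 + m)) → Adj G (v (inject₁ i)) (v (suc i)) × col (v (inject₁ i)) (v (suc i)) ≡ c
    close : Adj G (v (fromℕ (2 + m))) (v zero) × col (v (fromℕ (2 + m))) (v zero) ≡ c

Ramsey : Graph → Set
Ramsey G = (κ : Colouring G) → MonoCycle G κ

Minimal : Graph → Set₁
Minimal G = Ramsey G × (∀ H → ProperSubgraph H G → ¬ Ramsey H)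

-- Edge contraction G / uv: v is merged into u; the result is simple.

private
  contractRaw : (n' : ℕ) (A : Fin (suc n') → Fin (suc n') → Set)
                (d : ∀ i j → Dec (A i j)) (s : ∀ {i j} → A i j → A j i) (u v : Fin (suc n')) → u ≢ v → Graph
  contractRaw n' A d s u v u≢v = record
    { n = n'
    ; Adj = A'
    ; adj? = λ a b → ¬? (a ≟ b) ×-dec FinP.any? (λ x → FinP.any? (λ y →
                        (q x ≟ a) ×-dec ((q y ≟ b) ×-dec d x y)))
    ; adj-sym = λ { (ne , x , y , qx , qy , axy) → (λ e → ne (sym e)) , y , x , qy , qx , s axy }
    ; irrefl = λ { (ne , _) → ne refl }
    }
    where
    q : Fin (suc n') → Fin n'
    q x with v ≟ x
    ... | yes _ = punchOut {i = v} {j = u} (λ e → u≢v (sym e))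
    ... | no p  = punchOut p
    A' : Fin n' → Fin n' → Set
    A' a b = a ≢ b × ∃ λ x → ∃ λ y → q x ≡ a × q y ≡ b × A x y

  contractN : (k : ℕ) (A : Fin k → Fin k → Set) (d : ∀ i j → Dec (A i j))
              (s : ∀ {i j} → A i j → A j i) (u v : Fin k) → u ≢ v → Graph
  contractN zero    A d s () v ne
  contractN (suc k) A d s u  v ne = contractRaw k A d s u v ne

contract : (G : Graph) (u v : Fin (n G)) → Adj G u v → Graph
contract G u v e = contractN (n G) (Adj G) (adj? G) (adj-sym G) u v
  (λ u≡v → irrefl G (subst (λ w → Adj G u w) (sym u≡v) e))

data Minor (H : Graph) : Graph → Set₁ where
  sub  : ∀ {G} → H ⊆ G → Minor H G
  con  : ∀ {G} (u v : Fin (n G)) (e : Adj G u v) → Minor H (contract G u v e) → Minor H G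

AtMostOneTriangle : (G : Graph) (u v : Fin (n G)) → Set
AtMostOneTriangle G u v = ∀ w w' → Adj G u w → Adj G v w → Adj G u w' → Adj G v w' → w ≡ w'

Base : Graph → Set
Base G = (G ≅ K5-e) ⊎ (G ≅ K4∨K4)

MinorChain : Graph → Set₁
MinorChain G = ∃ λ (len : ℕ) → Σ (Fin (suc len) → Graph) λ Gs →
    (∀ k → Minimal (Gs k))
  × Base (Gs zero)
  × Gs (fromℕ len) ≡ G
  × (∀ (k : Fin len) → Minor (Gs (inject₁ k)) (Gs (suc k)))

-- "In fact" part: the reduction can be performed with arbitrary choices.
-- Greedy G : either G is a base graph, or G has an edge in at most one
-- triangle, and for EVERY edge f = uv in at most one triangle, G/f ∈ 𝓡(𝓒)
-- and EVERY H ∈ 𝓜(𝓒) that is a subgraph of G/f again satisfies Greedy.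
-- (Being inductive, every sequence of such choices terminates.)
data Greedy (G : Graph) : Set₁ where
  done : Base G → Greedy G
  step : (∃ λ u → ∃ λ v → Adj G u v × AtMostOneTriangle G u v)
       → (∀ u v (e : Adj G u v) → AtMostOneTriangle G u v →
            Ramsey (contract G u v e)
          × (∀ H → Minimal H → H ⊆ contract G u v e → Greedy H))
       → Greedy G

{-# OPTIONS --safe #-}
module Submission where

-- Only the easy half of Nash-Williams' theorem is needed: a graph whose degree sum is at least 4n − 2
-- has a monochromatic cycle in every 2-colouring, hence a minimal Ramsey graph has degree sum below 4n.
--
-- Contraction. Pull a colouring of G / uv back to G. If uv lies in no triangle, a monochromatic cycle of G
-- projects to a subgraph without vertices of degree one, so to a cycle. If uvw is the only triangle, give
-- one of uw, vw the colour opposite to that of their common image, and uv the colour of the image. Each of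
-- the two choices yields a monochromatic cycle, and either one of them projects as before, or their sum
-- modulo 2 with the triangle uvw does.
--
-- Structure. Suppose every edge of G lies in two triangles, and G contains neither K₅ − e nor K₄ ∨ K₄. Every
-- vertex of degree 3 then lies in a K₄, two such K₄'s share at most one vertex, and a K₄ has at most two
-- vertices of degree 3, since any colouring of the rest of G extends to three such vertices. Writing
-- t(v) for the number of neighbours of v of degree 3, this gives t(v) + 8 ≤ 2 deg v + 3 [deg v = 3]. As Σ t(v) = 3 #{v : deg v = 3},
-- summing over v gives degree sum at least 4n, a contradiction.

open import Defs
open import Algebra.Bundles using (CommutativeRing)
import Algebra.Properties.CommutativeMonoid.Sum as FiniteSum
open import Data.Bool using (Bool; true; false; _∧_; _xor_; not; if_then_else_)
import Data.Bool.Properties as Bool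
open import Data.Bool.Properties using (xor-∧-commutativeRing; ∧-zeroʳ; ∧-identityʳ; xor-comm; xor-same; xor-assoc; xor-identityʳ)
open import Data.Empty using (⊥; ⊥-elim)
open import Data.Fin using (Fin; zero; suc; inject₁; fromℕ; toℕ; inject≤; _≟_; punchIn; punchOut)
open import Data.Fin.Properties using (suc-injective; injective⇒≤; any?; all?; toℕ<n; toℕ-injective; toℕ-inject≤; toℕ-inject₁;
  toℕ-fromℕ; inject≤-injective; 0≢1+n; punchOut-injective; punchOut-cong; punchIn-injective; punchInᵢ≢i; punchIn-punchOut)
open import Data.List using ([]; _∷_; length)
open import Data.List.Relation.Unary.All as All using (All; []; _∷_)
open import Data.List.Relation.Unary.AllPairs using ([]; _∷_)
open import Data.List.Relation.Unary.Any using (Any; here; there)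
open import Data.List.Relation.Unary.Unique.Propositional using (Unique)
open import Data.Nat using (ℕ; zero; suc; _+_; _*_; _≤_; _<_; z≤n; s≤s; s≤s⁻¹)
import Data.Nat.Properties as ℕ
open import Data.Nat.Solver using (module +-*-Solver)
open import Data.Product using (∃; _×_; _,_; proj₁; proj₂)
open import Data.Sum using (_⊎_; inj₁; inj₂)
open import Data.Vec using (Vec; []; _∷_; lookup)
import Data.Vec.Functional as Vector
open import Data.Vec.Relation.Unary.All using ([]; _∷_)
open import Data.Vec.Relation.Unary.AllPairs using ([]; _∷_)
import Data.Vec.Relation.Unary.Unique.Propositional as Vec
open import Data.Vec.Relation.Unary.Unique.Propositional.Properties using (lookup-injective)
open import Function using (_∘_; case_of_; mk⇔)
open import Function.Definitions using (Injective)
open import Relation.Nullary using (¬_; Dec; yes; no; does)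
open import Relation.Nullary.Decidable using (_×-dec_; _→-dec_; _⊎-dec_; ¬?; map′; decidable-stable; does-⇔; dec-true; dec-false)
open import Relation.Binary.PropositionalEquality
  using (_≡_; _≢_; refl; sym; trans; cong; cong₂; subst; subst₂; module ≡-Reasoning)
open Colouring

-- Cycles and even subgraphs

Rel : ℕ → Set₁
Rel N = Fin N → Fin N → Set

Symm : ∀ {N} → Rel N → Set
Symm R = ∀ {x y} → R x y → R y x

Matrix : ℕ → Set
Matrix N = Fin N → Fin N → Bool

module ⊕ = FiniteSum (CommutativeRing.+-commutativeMonoid xor-∧-commutativeRing)

⊕-false : ∀ {k} {f : Fin k → Bool} → (∀ i → f i ≡ false) → ⊕.sum f ≡ false
⊕-false {zero} h = refl
⊕-false {suc k} {f} h rewrite h zero = ⊕-false (h ∘ suc)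

⊕-true : ∀ {k} (f : Fin k → Bool) → ⊕.sum f ≡ true → ∃ λ i → f i ≡ true
⊕-true {suc k} f h with f zero in eq
... | true  = zero , eq
... | false with ⊕-true (f ∘ suc) h
...   | i , fi = suc i , fi

⊕-single : ∀ {k} {f : Fin k → Bool} x → (∀ y → y ≢ x → f y ≡ false) → ⊕.sum f ≡ f x
⊕-single {suc k} {f} zero h
  rewrite ⊕-false {f = f ∘ suc} (λ i → h (suc i) λ ()) = xor-identityʳ (f zero)
⊕-single {suc k} {f} (suc x) h
  rewrite h zero (λ ()) = ⊕-single x (λ y ne → h (suc y) (ne ∘ suc-injective))

⊕-telescope : ∀ {k} (f : Fin (suc k) → Bool) →
  ⊕.sum (λ i → f (inject₁ i) xor f (suc i)) ≡ f zero xor f (fromℕ k)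
⊕-telescope {zero} f = sym (xor-same (f zero))
⊕-telescope {suc k} f = begin
  (a xor b) xor ⊕.sum (λ i → f (inject₁ (suc i)) xor f (suc (suc i)))
    ≡⟨ cong ((a xor b) xor_) (⊕-telescope (f ∘ suc)) ⟩
  (a xor b) xor (b xor c) ≡⟨ xor-assoc a b (b xor c) ⟩
  a xor (b xor (b xor c)) ≡⟨ cong (a xor_) (xor-assoc b b c) ⟨
  a xor ((b xor b) xor c) ≡⟨ cong (λ t → a xor (t xor c)) (xor-same b) ⟩
  a xor c ∎
  where
  open ≡-Reasoning
  a = f zero
  b = f (suc zero)
  c = f (fromℕ (suc k))

δ : ∀ {N} → Matrix N
δ x y = does (x ≟ y)

δ-refl : ∀ {N} (x : Fin N) → δ x x ≡ true
δ-refl x = dec-true (x ≟ x) refl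

δ-≢ : ∀ {N} {x y : Fin N} → x ≢ y → δ x y ≡ false
δ-≢ {x = x} {y} = dec-false (x ≟ y)

⊕-δ : ∀ {N} b (q : Fin N) → ⊕.sum (λ y → b ∧ δ y q) ≡ b
⊕-δ b q = begin
  ⊕.sum (λ y → b ∧ δ y q) ≡⟨ ⊕-single q (λ y ne → trans (cong (b ∧_) (δ-≢ ne)) (∧-zeroʳ b)) ⟩
  b ∧ δ q q               ≡⟨ cong (b ∧_) (δ-refl q) ⟩
  b ∧ true                ≡⟨ ∧-identityʳ b ⟩
  b                       ∎
  where open ≡-Reasoning

-- The edge {p, q} as a matrix over 𝔽₂.
ε : ∀ {N} → Fin N → Fin N → Matrix N
ε p q x y = (δ x p ∧ δ y q) xor (δ x q ∧ δ y p)

ε-sym : ∀ {N} (p q x y : Fin N) → ε p q x y ≡ ε p q y x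
ε-sym p q x y
  rewrite Bool.∧-comm (δ x p) (δ y q) | Bool.∧-comm (δ x q) (δ y p) = xor-comm (δ y q ∧ δ x p) _

ε-row : ∀ {N} (p q x : Fin N) → ⊕.sum (ε p q x) ≡ δ x p xor δ x q
ε-row p q x = trans (⊕.∑-distrib-+ (λ y → δ x p ∧ δ y q) (λ y → δ x q ∧ δ y p))
                    (cong₂ _xor_ (⊕-δ (δ x p) q) (⊕-δ (δ x q) p))

ε-support : ∀ {N} (p q x y : Fin N) → ε p q x y ≡ true → (x ≡ p × y ≡ q) ⊎ (x ≡ q × y ≡ p)
ε-support p q x y h with x ≟ p | y ≟ q | x ≟ q | y ≟ p
... | yes a | yes b | _     | _     = inj₁ (a , b)
... | _     | _     | yes a | yes b = inj₂ (a , b)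
ε-support p q x y () | yes _ | no _ | yes _ | no _
ε-support p q x y () | yes _ | no _ | no _ | _
ε-support p q x y () | no _ | _ | yes _ | no _
ε-support p q x y () | no _ | _ | no _ | _

ε-refl : ∀ {N} {p q : Fin N} → p ≢ q → ε p q p q ≡ true
ε-refl {p = p} {q} ne rewrite δ-refl p | δ-refl q | δ-≢ ne = refl

ε-off : ∀ {N} (p q x y : Fin N) → ¬ ((x ≡ p × y ≡ q) ⊎ (x ≡ q × y ≡ p)) → ε p q x y ≡ false
ε-off p q x y h = Bool.¬-not (h ∘ ε-support p q x y)

record Cycle {N : ℕ} (R : Rel N) : Set where
  field
    excess   : ℕ
    vertex   : Fin (3 + excess) → Fin N
    distinct : Injective _≡_ _≡_ vertex
    steps    : ∀ (i : Fin (2 + excess)) → R (vertex (inject₁ i)) (vertex (suc i))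
    closes   : R (vertex (fromℕ (2 + excess))) (vertex zero)

-- A nonzero element of the 𝔽₂ cycle space of `R`. In this form subgraphs can be added modulo 2 and
-- searched exhaustively.
record EvenIn {N : ℕ} (R : Rel N) (E : Matrix N) : Set where
  field
    symmetric : ∀ x y → E x y ≡ E y x
    even      : ∀ x → ⊕.sum (E x) ≡ false
    support   : ∀ x y → E x y ≡ true → R x y
    edge      : ∃ λ x → ∃ λ y → E x y ≡ true

-- A graph with an edge and no vertex of degree one contains a cycle, so exhibiting a Core of R
-- is as good as exhibiting a cycle, and easier.
record Core {N : ℕ} (R : Rel N) : Set₁ where
  field
    _∼_     : Rel N
    ∼-sym   : Symm _∼_
    ∼⇒R     : ∀ {x y} → x ∼ y → R x y
    edge    : ∃ λ x → ∃ λ y → x ∼ y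
    branch  : ∀ {x y} → x ∼ y → ∃ λ z → z ≢ y × x ∼ z

-- The edges of the cycle are summed modulo 2. Each row telescopes along the path, and the closing
-- edge cancels the two ends.
cycle⇒even : ∀ {N} {R : Rel N} → Symm R → Cycle R → ∃ (EvenIn R)
cycle⇒even {N} {R} R-sym C = E , record
  { symmetric = λ x y → cong₂ _xor_ (⊕.sum-cong-≗ (λ i → ε-sym (v (inject₁ i)) (v (suc i)) x y))
                                    (ε-sym vω v₀ x y)
  ; even      = rows
  ; support   = supp
  ; edge      = v₀ , v₁ , E-edge
  }
  where
  open Cycle C renaming (vertex to v)
  v₀ = v zero
  v₁ = v (suc zero)
  vω = v (fromℕ (2 + excess))
  term : Fin (2 + excess) → Matrix N
  term i = ε (v (inject₁ i)) (v (suc i))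
  E : Matrix N
  E x y = ⊕.sum (λ i → term i x y) xor ε vω v₀ x y
  rows : ∀ x → ⊕.sum (E x) ≡ false
  rows x = begin
    ⊕.sum (E x)
      ≡⟨ ⊕.∑-distrib-+ (λ y → ⊕.sum (λ i → term i x y)) (ε vω v₀ x) ⟩
    ⊕.sum (λ y → ⊕.sum (λ i → term i x y)) xor ⊕.sum (ε vω v₀ x)
      ≡⟨ cong₂ _xor_ (⊕.∑-comm (λ y i → term i x y)) (ε-row vω v₀ x) ⟩
    ⊕.sum (λ i → ⊕.sum (term i x)) xor (δ x vω xor δ x v₀)
      ≡⟨ cong (_xor (δ x vω xor δ x v₀)) (⊕.sum-cong-≗ (λ i → ε-row (v (inject₁ i)) (v (suc i)) x)) ⟩
    ⊕.sum (λ i → δ x (v (inject₁ i)) xor δ x (v (suc i))) xor (δ x vω xor δ x v₀)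
      ≡⟨ cong (_xor (δ x vω xor δ x v₀)) (⊕-telescope (δ x ∘ v)) ⟩
    (δ x v₀ xor δ x vω) xor (δ x vω xor δ x v₀)
      ≡⟨ cong ((δ x v₀ xor δ x vω) xor_) (xor-comm (δ x vω) (δ x v₀)) ⟩
    (δ x v₀ xor δ x vω) xor (δ x v₀ xor δ x vω)
      ≡⟨ xor-same (δ x v₀ xor δ x vω) ⟩
    false ∎
    where open ≡-Reasoning
  orient : ∀ {p q x y : Fin N} → R p q → ε p q x y ≡ true → R x y
  orient {p} {q} {x} {y} r h with ε-support p q x y h
  ... | inj₁ (refl , refl) = r
  ... | inj₂ (refl , refl) = R-sym r
  supp : ∀ x y → E x y ≡ true → R x y
  supp x y h with ε vω v₀ x y in eq
  ... | true  = orient closes eq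
  ... | false with ⊕-true (λ i → term i x y) (trans (sym (xor-identityʳ _)) h)
  ...   | i , hi = orient (steps i) hi
  -- This edge is used only once: the vertices are distinct and, the length being at least three,
  -- `vω` is neither of its ends.
  E-edge : E v₀ v₁ ≡ true
  E-edge = cong₂ _xor_
    (trans (⊕-single {f = λ i → term i v₀ v₁} zero later)
           (ε-refl λ e → 0≢1+n (distinct e)))
    (ε-off vω v₀ v₀ v₁ λ { (inj₁ (_ , e)) → 0≢1+n (sym (distinct e))
             ; (inj₂ (_ , e)) → 0≢1+n (suc-injective (distinct e)) })
    where
    later : ∀ i → i ≢ zero → term i v₀ v₁ ≡ false
    later zero ne = ⊥-elim (ne refl)
    later (suc i) _ = ε-off (v (inject₁ (suc i))) (v (suc (suc i))) v₀ v₁ λ { (inj₁ (e , _)) → 0≢1+n (distinct e)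
                              ; (inj₂ (e , _)) → 0≢1+n (distinct e) }

-- A row with exactly one entry `true` has odd sum, so no vertex of an even subgraph has degree one.
even⇒core : ∀ {N} {R : Rel N} {E} → EvenIn R E → Core R
even⇒core {E = E} ev = record
  { _∼_    = λ x y → E x y ≡ true
  ; ∼-sym  = λ {x} {y} h → trans (symmetric y x) h
  ; ∼⇒R    = λ {x} {y} → support x y
  ; edge   = edge
  ; branch = λ {x} {y} → branch x y
  }
  where
  open EvenIn ev
  branch : ∀ x y → E x y ≡ true → ∃ λ z → z ≢ y × E x z ≡ true
  branch x y h with any? (λ z → ¬? (z ≟ y) ×-dec (E x z Bool.≟ true))
  ... | yes found = found
  ... | no none with trans (sym (even x)) (trans (⊕-single y (λ z ne → Bool.¬-not λ e → none (z , ne , e))) h)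
  ...   | ()

-- A path is extended at its head, which has a neighbour other than its successor: a new one
-- lengthens the path, an old one closes a cycle with an initial segment.
core⇒cycle : ∀ {N} {R : Rel N} → (∀ {x} → ¬ R x x) → Core R → Cycle R
core⇒cycle {N} {R} irr core = grow N 0 refl start start-inj λ { zero → proj₂ (proj₂ edge) }
  where
  open Core core
  IsPath : ∀ {k} → (Fin (2 + k) → Fin N) → Set
  IsPath p = ∀ i → p (inject₁ i) ∼ p (suc i)

  start : Fin 2 → Fin N
  start zero    = proj₁ edge
  start (suc _) = proj₁ (proj₂ edge)

  start-inj : Injective _≡_ _≡_ start
  start-inj {zero} {zero} e = refl
  start-inj {zero} {suc zero} e = ⊥-elim (irr (∼⇒R (subst (_ ∼_) (sym e) (proj₂ (proj₂ edge)))))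
  start-inj {suc zero} {zero} e = ⊥-elim (irr (∼⇒R (subst (_ ∼_) e (proj₂ (proj₂ edge)))))
  start-inj {suc zero} {suc zero} e = refl

  -- The head is joined to position `2 + j`, so the cycle consists of the first `3 + j` vertices.
  close : ∀ {k} (p : Fin (2 + k) → Fin N) → Injective _≡_ _≡_ p → IsPath p →
          (j : Fin k) → p zero ∼ p (suc (suc j)) → Cycle R
  close {k} p p-inj path j h = record
    { excess   = toℕ j
    ; vertex   = λ t → p (inject≤ t le)
    ; distinct = λ e → inject≤-injective _ _ _ _ (p-inj e)
    ; steps    = λ t → ∼⇒R (subst (λ s → p s ∼ p (suc (inject≤ t le′)))
                                  (toℕ-injective (trans (toℕ-inject₁ _) (trans (toℕ-inject≤ t le′)
                                     (sym (trans (toℕ-inject≤ (inject₁ t) le) (toℕ-inject₁ t))))))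
                                  (path (inject≤ t le′)))
    ; closes   = ∼⇒R (subst (λ s → p s ∼ p zero)
                            (toℕ-injective (sym (trans (toℕ-inject≤ (fromℕ (2 + toℕ j)) le) (toℕ-fromℕ _))))
                            (∼-sym h))
    }
    where
    le′ : 2 + toℕ j ≤ 1 + k
    le′ = _≤_.s≤s (toℕ<n j)
    le : 3 + toℕ j ≤ 2 + k
    le = _≤_.s≤s le′

  cons-inj : ∀ {k} {w} {p : Fin k → Fin N} → Injective _≡_ _≡_ p → (∀ i → p i ≢ w) → Injective _≡_ _≡_ (w Vector.∷ p)
  cons-inj p-inj new {zero}  {zero}  e = refl
  cons-inj p-inj new {zero}  {suc j} e = ⊥-elim (new j (sym e))
  cons-inj p-inj new {suc i} {zero}  e = ⊥-elim (new i e)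
  cons-inj p-inj new {suc i} {suc j} e = cong suc (p-inj e)

  grow : ∀ fuel k → k + fuel ≡ N → (p : Fin (2 + k) → Fin N) → Injective _≡_ _≡_ p → IsPath p → Cycle R
  -- Out of fuel, `k` equals `N`, and `2 + N` distinct vertices are impossible.
  grow zero k e p p-inj path = ⊥-elim (ℕ.1+n≰n (ℕ.≤-trans (ℕ.n≤1+n _)
    (subst (2 + k ≤_) (trans (sym e) (ℕ.+-identityʳ k)) (injective⇒≤ p-inj))))
  grow (suc fuel) k e p p-inj path with branch (path zero)
  ... | w , w≢p₁ , p₀∼w with any? (λ i → p i ≟ w)
  ...   | no new = grow fuel (suc k) (trans (sym (ℕ.+-suc k fuel)) e) (w Vector.∷ p)
                     (cons-inj p-inj λ i e → new (i , e))
                     λ { zero → ∼-sym p₀∼w ; (suc i) → path i }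
  ...   | yes (zero , refl)        = ⊥-elim (irr (∼⇒R p₀∼w))
  ...   | yes (suc zero , e)       = ⊥-elim (w≢p₁ (sym e))
  ...   | yes (suc (suc j) , refl) = close p p-inj path j p₀∼w

-- Contracting an edge in at most one triangle

adj-≢ : ∀ G {x y} → Adj G x y → x ≢ y
adj-≢ G a refl = irrefl G a

Class : (G : Graph) → Colouring G → Bool → Rel (n G)
Class G κ c x y = Adj G x y × col κ x y ≡ c

class-sym : ∀ G κ c → Symm (Class G κ c)
class-sym G κ c {x} {y} (a , e) = adj-sym G a , trans (col-sym κ y x) e

mono⇒cycle : ∀ {G κ} (C : MonoCycle G κ) → Cycle (Class G κ (MonoCycle.c C))
mono⇒cycle C = record
  { excess = m ; vertex = v ; distinct = v-inj ; steps = MonoCycle.step C ; closes = close }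
  where open MonoCycle C hiding (step)

cycle⇒mono : ∀ {G κ c} → Cycle (Class G κ c) → MonoCycle G κ
cycle⇒mono {c = c} C = record
  { m = excess ; v = vertex ; v-inj = distinct ; c = c ; step = steps ; close = closes }
  where open Cycle C

mono⇒even : ∀ {G κ} → MonoCycle G κ → ∃ λ c → ∃ (EvenIn (Class G κ c))
mono⇒even {G} {κ} C = MonoCycle.c C , cycle⇒even (class-sym G κ (MonoCycle.c C)) (mono⇒cycle C)

core⇒mono : ∀ {G κ} c → Core (Class G κ c) → MonoCycle G κ
core⇒mono {G} {κ} c C = cycle⇒mono (core⇒cycle (irrefl G ∘ proj₁) C)

OneOf : ∀ {N} (u v x y : Fin N) → Set
OneOf u v x y = (x ≡ u × y ≡ v) ⊎ (x ≡ v × y ≡ u)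

record Projection (G H : Graph) (u v : Fin (n G)) : Set where
  field
    q        : Fin (n G) → Fin (n H)
    q-merges : q u ≡ q v
    q-fibres : ∀ x y → q x ≡ q y → x ≡ y ⊎ OneOf u v x y
    q-adj    : ∀ {x y} → Adj G x y → q x ≢ q y → Adj H (q x) (q y)

-- The map along which Defs.contract identifies vertices is local to that definition;
-- unifying with the adjacency relation of the contraction recovers it.
data ImageOf {N N′ : ℕ} (A : Rel N) : Rel N′ → Set₁ where
  along : (q : Fin N → Fin N′) →
          ImageOf A (λ a b → a ≢ b × ∃ λ x → ∃ λ y → q x ≡ a × q y ≡ b × A x y)

map-of : ∀ {N N′} {A : Rel N} {B : Rel N′} → ImageOf A B → Fin N → Fin N′
map-of (along q) = q

contract-size : ∀ G u v e → suc (n (contract G u v e)) ≡ n G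
contract-size record { n = suc k } u v e = refl

projection : ∀ G u v (e : Adj G u v) → Projection G (contract G u v e) u v
-- Exposing the successor lets the contraction reduce, so that `along _` can be solved by
-- unification.
projection G@(record { n = suc k ; Adj = A }) u v e = record
  { q = q ; q-merges = q-merges ; q-fibres = q-fibres
  ; q-adj = λ {x} {y} a ne → ne , x , y , refl , refl , a }
  where
  image : ImageOf A (Adj (contract G u v e))
  image = along _
  q : Fin (suc k) → Fin k
  q = map-of image
  v≢u : v ≢ u
  v≢u refl = irrefl G e
  q-v : q v ≡ punchOut v≢u
  q-v with v ≟ v
  ... | yes _ = punchOut-cong v refl
  ... | no ne = ⊥-elim (ne refl)
  q-other : ∀ x (ne : v ≢ x) → q x ≡ punchOut ne
  q-other x ne with v ≟ x
  ... | yes eq = ⊥-elim (ne eq)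
  ... | no _   = punchOut-cong v refl
  q-merges : q u ≡ q v
  q-merges = trans (q-other u v≢u) (sym q-v)
  q-fibres : ∀ x y → q x ≡ q y → x ≡ y ⊎ OneOf u v x y
  q-fibres x y eq with v ≟ x in ex | v ≟ y in ey
  ... | yes refl | yes refl = inj₁ refl
  ... | yes refl | no ny    = inj₂ (inj₂ (refl , sym (punchOut-injective {i = v} {_} {_} _ _ eq)))
  ... | no nx    | yes refl = inj₂ (inj₁ (punchOut-injective {i = v} {_} {_} _ _ eq , refl))
  ... | no nx    | no ny    = inj₁ (punchOut-injective {i = v} {_} {_} _ _ eq)

module _ {G H : Graph} {u v : Fin (n G)} (π : Projection G H u v) where
  open Projection π

  -- Edges from `x` to `y` and `y′` can fall together only if `y`, `y′` are `u`, `v`, which is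
  -- excluded since `u` and `v` have no common neighbour in the core. If the second edge at `x` is
  -- `uv` itself, it is followed to its other end and continued from there.
  project-core : ∀ {R : Rel (n G)} {R′ : Rel (n H)} (C : Core R) → (let _∼_ = Core._∼_ C) →
    (∀ {x} → ¬ R x x) → (∀ {x} → x ∼ u → x ∼ v → ⊥) →
    (∀ {x y} → x ∼ y → q x ≢ q y → R′ (q x) (q y)) → Core R′
  project-core {R} {R′} C R-irr apart edge⇒R′ = record
    { _∼_    = _∼′_
    ; ∼-sym  = λ { (ne , x , y , ex , ey , h) → (ne ∘ sym) , y , x , ey , ex , ∼-sym h }
    ; ∼⇒R    = λ { (ne , x , y , refl , refl , h) → edge⇒R′ h ne }
    ; edge   = edge′ edge
    ; branch = λ { (ne , x , y , refl , refl , h) → branch′ ne h }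
    }
    where
    open Core C
    _∼′_ : Rel (n H)
    a ∼′ b = a ≢ b × ∃ λ x → ∃ λ y → q x ≡ a × q y ≡ b × x ∼ y

    irr : ∀ {x y} → x ∼ y → x ≢ y
    irr h refl = R-irr (∼⇒R h)

    apart′ : ∀ {x y z} → OneOf u v y z → x ∼ y → x ∼ z → ⊥
    apart′ (inj₁ (refl , refl)) h k = apart h k
    apart′ (inj₂ (refl , refl)) h k = apart k h

    lift : ∀ {x y} → q x ≢ q y → x ∼ y → q x ∼′ q y
    lift ne h = ne , _ , _ , refl , refl , h

    other-end : ∀ {x y z} → OneOf u v x y → OneOf u v z y → z ≡ x
    other-end (inj₁ (refl , refl)) (inj₁ (refl , _)) = refl
    other-end (inj₁ (refl , refl)) (inj₂ (refl , refl)) = refl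
    other-end (inj₂ (refl , refl)) (inj₁ (refl , refl)) = refl
    other-end (inj₂ (refl , refl)) (inj₂ (refl , _)) = refl

    swap : ∀ {x y} → OneOf u v x y → OneOf u v y x
    swap (inj₁ (a , b)) = inj₂ (b , a)
    swap (inj₂ (a , b)) = inj₁ (b , a)

    edge′ : (∃ λ x → ∃ λ y → x ∼ y) → ∃ λ a → ∃ λ b → a ∼′ b
    edge′ (x , y , h) with q x ≟ q y
    ... | no ne = _ , _ , lift ne h
    ... | yes eq with q-fibres x y eq | branch h
    ...   | inj₁ x≡y | _ = ⊥-elim (irr h x≡y)
    -- The given edge is `uv` and disappears; a second edge at `x` survives.
    ...   | inj₂ xy  | y′ , y′≢y , h′ = _ , _ , lift ne h′
      where
      ne : q x ≢ q y′
      ne eq′ with q-fibres x y′ eq′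
      ... | inj₁ x≡y′ = irr h′ x≡y′
      ... | inj₂ xy′  = y′≢y (other-end (swap xy) (swap xy′))

    branch′ : ∀ {x y} → q x ≢ q y → x ∼ y → ∃ λ c → c ≢ q y × q x ∼′ c
    branch′ {x} {y} ne h with branch h
    ... | y′ , y′≢y , h′ with q x ≟ q y′
    ...   | no ne′ = q y′ , (λ eq → same-fibre (q-fibres y′ y eq)) , lift ne′ h′
      where
      same-fibre : y′ ≡ y ⊎ OneOf u v y′ y → ⊥
      same-fibre (inj₁ e) = y′≢y e
      same-fibre (inj₂ p) = apart′ p h′ h
    ...   | yes eq with q-fibres x y′ eq | branch (∼-sym h′)
    ...     | inj₁ e | _ = ⊥-elim (irr h′ e)
    -- Here `x` and `y′` are the ends of `uv`, so the edge from `y′` to `z` also starts at the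
    -- merged vertex; `z ≡ y` would make `y` a common neighbour of `u` and `v`.
    ...     | inj₂ xy′ | z , z≢x , k = q z , ne-y ∘ q-fibres z y , subst (_∼′ q z) (sym eq) (lift (ne-y′ ∘ q-fibres y′ z) k)
      where
      ne-y′ : y′ ≡ z ⊎ OneOf u v y′ z → ⊥
      ne-y′ (inj₁ e) = irr k e
      ne-y′ (inj₂ p) = z≢x (other-end xy′ (swap p))
      disjoint : OneOf u v x y′ → OneOf u v z y → ⊥
      disjoint (inj₁ (refl , refl)) (inj₁ (_ , e)) = y′≢y (sym e)
      disjoint (inj₁ (refl , refl)) (inj₂ (_ , e)) = irr h (sym e)
      disjoint (inj₂ (refl , refl)) (inj₁ (_ , e)) = irr h (sym e)
      disjoint (inj₂ (refl , refl)) (inj₂ (_ , e)) = y′≢y (sym e)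
      ne-y : z ≡ y ⊎ OneOf u v z y → ⊥
      ne-y (inj₁ refl) = apart′ xy′ (∼-sym h) (∼-sym k)
      ne-y (inj₂ p) = disjoint xy′ p

xor-true : ∀ a b → a xor b ≡ true → a ≡ true ⊎ b ≡ true
xor-true true  b h = inj₁ refl
xor-true false b h = inj₂ h

module _ {G H : Graph} {u v : Fin (n G)} (π : Projection G H u v)
         (u~v : Adj G u v) (few : AtMostOneTriangle G u v) (RG : Ramsey G) (κ : Colouring H) where
  open Projection π

  pulled : Fin (n G) → Fin (n G) → Bool
  pulled x y = col κ (q x) (q y)

  not-one : ∀ {x y} → q x ≢ q y → ε u v x y ≡ true → ⊥
  not-one {x} {y} ne h with ε-support u v x y h
  ... | inj₁ (refl , refl) = ne q-merges
  ... | inj₂ (refl , refl) = ne (sym q-merges)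

  no-triangle : (∀ {w} → Adj G u w → Adj G v w → ⊥) → MonoCycle H κ
  no-triangle none with mono⇒even (RG record { col = pulled ; col-sym = λ x y → col-sym κ (q x) (q y) })
  ... | c , E , ev = core⇒mono c (project-core π (even⇒core ev) (irrefl G ∘ proj₁)
      (λ h k → none (adj-sym G (proj₁ (EvenIn.support ev _ _ h))) (adj-sym G (proj₁ (EvenIn.support ev _ _ k))))
      λ h ne → let (a , e) = EvenIn.support ev _ _ h in q-adj a ne , e)

  module _ {w : Fin (n G)} (u~w : Adj G u w) (v~w : Adj G v w) where
    c₀ : Bool
    c₀ = pulled u w

    u≢v = adj-≢ G u~v
    u≢w = adj-≢ G u~w
    v≢w = adj-≢ G v~w

    pulled-vw : pulled v w ≡ c₀
    pulled-vw = cong (λ t → col κ t (q w)) (sym q-merges)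

    shade : Fin (n G) → Fin (n G) → Fin (n G) → Bool
    shade a x y = if ε u v x y then c₀ else if ε a w x y then not c₀ else pulled x y

    -- Of the two edges of G over the edge {q u, q w} of H, the one at a changes colour.
    shading : Fin (n G) → Colouring G
    shading a = record { col = shade a ; col-sym = λ x y → cong₂ (λ s t → if s then c₀ else t) (ε-sym u v x y)
                (cong₂ (λ s t → if s then not c₀ else t) (ε-sym a w x y) (col-sym κ (q x) (q y))) }

    shade-uv : ∀ a → shade a u v ≡ c₀
    shade-uv a rewrite ε-refl u≢v = refl

    shade-aw : ∀ {a} → a ≡ u ⊎ a ≡ v → shade a a w ≡ not c₀
    shade-aw (inj₁ refl) rewrite ε-off u v u w (λ { (inj₁ (_ , e)) → v≢w (sym e) ; (inj₂ (e , _)) → u≢v e })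
      | ε-refl u≢w = refl
    shade-aw (inj₂ refl) rewrite ε-off u v v w (λ { (inj₁ (e , _)) → u≢v (sym e) ; (inj₂ (_ , e)) → u≢w (sym e) })
      | ε-refl v≢w = refl

    shade-off : ∀ a {x y} → ε u v x y ≡ false → ε a w x y ≡ false → shade a x y ≡ pulled x y
    shade-off a e₁ e₂ rewrite e₁ | e₂ = refl

    absent : ∀ {c a E} → EvenIn (Class G (shading a) c) E → ∀ x y → shade a x y ≢ c → E x y ≡ false
    absent ev x y ne = Bool.¬-not λ h → ne (proj₂ (EvenIn.support ev x y h))

    -- A vertex joined to both ends of `uv` must be `w`; this is where `few` enters.
    apex : ∀ {R E} (ev : EvenIn R E) → (∀ {x y} → R x y → Adj G x y) →
           ∀ {x} → E x u ≡ true → E x v ≡ true → E u w ≡ true × E v w ≡ true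
    apex ev R⇒A {x} h k with few x w (adj-sym G (R⇒A (EvenIn.support ev _ _ h)))
                                      (adj-sym G (R⇒A (EvenIn.support ev _ _ k))) u~w v~w
    ... | refl = trans (EvenIn.symmetric ev u w) h , trans (EvenIn.symmetric ev v w) k

    -- Apart from `uv`, which is contracted, `a w` is the only edge whose colour differs from that
    -- of its image. In its absence all surviving edges keep their colour, and by `apex` no vertex
    -- is joined to both `u` and `v` in `E`.
    avoiding : ∀ {a c E} → a ≡ u ⊎ a ≡ v → EvenIn (Class G (shading a) c) E → E a w ≡ false → MonoCycle H κ
    avoiding {a} {c} {E} side ev E-aw = core⇒mono c (project-core π (even⇒core ev) (irrefl G ∘ proj₁) apart
        λ {x} {y} h ne → let (adj , e) = support x y h in
          q-adj adj ne , trans (sym (shade-off a (Bool.¬-not (not-one ne)) (Bool.¬-not (not-aw h)))) e)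
      where
      open EvenIn ev
      contra : ∀ {b} → b ≡ true → b ≡ false → ⊥
      contra refl ()
      at : ∀ {b} → b ≡ u ⊎ b ≡ v → E u w ≡ true × E v w ≡ true → E b w ≡ true
      at (inj₁ refl) = proj₁
      at (inj₂ refl) = proj₂
      apart : ∀ {x} → E x u ≡ true → E x v ≡ true → ⊥
      apart h k = contra (at side (apex ev proj₁ h k)) E-aw
      not-aw : ∀ {x y} → E x y ≡ true → ε a w x y ≡ true → ⊥
      not-aw {x} {y} h k with ε-support a w x y k
      ... | inj₁ (refl , refl) = contra h E-aw
      ... | inj₂ (refl , refl) = contra (trans (symmetric _ _) h) E-aw

    -- The two even subgraphs and the triangle add up to an even subgraph avoiding both edges over {q u, q w}.
    both : ∀ {c c′ E E′} → EvenIn (Class G (shading u) c) E → EvenIn (Class G (shading v) c′) E′ →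
           E u w ≡ true → E′ v w ≡ true → MonoCycle H κ
    both {c} {c′} {E} {E′} ev ev′ E-uw E′-vw
      with trans (sym (proj₂ (EvenIn.support ev u w E-uw))) (shade-aw (inj₁ refl))
         | trans (sym (proj₂ (EvenIn.support ev′ v w E′-vw))) (shade-aw (inj₂ refl))
    -- Each subgraph contains its recoloured edge, so both have colour `not c₀`.
    ... | refl | refl = core⇒mono (not c₀) (project-core π (even⇒core sum-even) (irrefl G ∘ proj₁)
            (λ h k → contra (proj₂ (apex sum-even proj₁ h k)) D-vw) λ {x} {y} h ne → to-class {x} {y} h ne)
      where
      contra : ∀ {b} → b ≡ true → b ≡ false → ⊥
      contra refl ()
      triangle D : Matrix (n G)
      triangle x y = ε u v x y xor (ε u w x y xor ε v w x y)
      D x y = (E x y xor E′ x y) xor triangle x y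
      D-sym : ∀ x y → D x y ≡ D y x
      D-sym x y = cong₂ _xor_ (cong₂ _xor_ (EvenIn.symmetric ev x y) (EvenIn.symmetric ev′ x y))
        (cong₂ _xor_ (ε-sym u v x y) (cong₂ _xor_ (ε-sym u w x y) (ε-sym v w x y)))
      D-rows : ∀ x → ⊕.sum (D x) ≡ false
      D-rows x = begin
        ⊕.sum (D x) ≡⟨ ⊕.∑-distrib-+ (λ y → E x y xor E′ x y) (triangle x) ⟩
        ⊕.sum (λ y → E x y xor E′ x y) xor ⊕.sum (triangle x)
          ≡⟨ cong₂ _xor_ (⊕.∑-distrib-+ (E x) (E′ x))
               (trans (⊕.∑-distrib-+ (ε u v x) _) (cong (⊕.sum (ε u v x) xor_) (⊕.∑-distrib-+ (ε u w x) (ε v w x)))) ⟩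
        (⊕.sum (E x) xor ⊕.sum (E′ x)) xor (⊕.sum (ε u v x) xor (⊕.sum (ε u w x) xor ⊕.sum (ε v w x)))
          ≡⟨ cong₂ _xor_ (cong₂ _xor_ (EvenIn.even ev x) (EvenIn.even ev′ x))
               (cong₂ _xor_ (ε-row u v x) (cong₂ _xor_ (ε-row u w x) (ε-row v w x))) ⟩
        (δ x u xor δ x v) xor ((δ x u xor δ x w) xor (δ x v xor δ x w)) ≡⟨ cancel (δ x u) (δ x v) (δ x w) ⟩
        false ∎
        where
        open ≡-Reasoning
        cancel : ∀ a b d → (a xor b) xor ((a xor d) xor (b xor d)) ≡ false
        cancel false false false = refl
        cancel false false true  = refl
        cancel false true  false = refl
        cancel false true  true  = refl
        cancel true  false false = refl
        cancel true  false true  = refl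
        cancel true  true  false = refl
        cancel true  true  true  = refl
      ≢not : ∀ {b} → b ≡ c₀ → b ≢ not c₀
      ≢not e f = Bool.not-¬ refl (trans (sym e) f)
      uv-uw : ε u v u w ≡ false
      uv-uw = ε-off u v u w λ { (inj₁ (_ , e)) → v≢w (sym e) ; (inj₂ (e , _)) → u≢v e }
      uv-vw : ε u v v w ≡ false
      uv-vw = ε-off u v v w λ { (inj₁ (e , _)) → u≢v (sym e) ; (inj₂ (_ , e)) → u≢w (sym e) }
      uw-vw : ε u w v w ≡ false
      uw-vw = ε-off u w v w λ { (inj₁ (e , _)) → u≢v (sym e) ; (inj₂ (e , _)) → v≢w e }
      vw-uw : ε v w u w ≡ false
      vw-uw = ε-off v w u w λ { (inj₁ (e , _)) → u≢v e ; (inj₂ (e , _)) → u≢w e }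
      uw-uv : ε u w u v ≡ false
      uw-uv = ε-off u w u v λ { (inj₁ (_ , e)) → v≢w e ; (inj₂ (e , _)) → u≢w e }
      vw-uv : ε v w u v ≡ false
      vw-uv = ε-off v w u v λ { (inj₁ (e , _)) → u≢v e ; (inj₂ (e , _)) → u≢w e }
      -- Both shadings give `uv` the colour `c₀`, so neither subgraph contains it and only the
      -- triangle contributes. In particular `D` is nonzero.
      D-uv : D u v ≡ true
      D-uv rewrite absent ev u v (≢not (shade-uv u)) | absent ev′ u v (≢not (shade-uv v))
        | ε-refl u≢v | uw-uv | vw-uv = refl
      -- `uw` lies in `E` and in the triangle, but not in `E′`, since the second shading gives it
      -- colour `c₀`. The argument for `vw` is symmetric.
      D-uw : D u w ≡ false
      D-uw rewrite E-uw | absent ev′ u w (≢not (shade-off v uv-uw vw-uw))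
        | uv-uw | ε-refl u≢w | vw-uw = refl
      D-vw : D v w ≡ false
      D-vw rewrite E′-vw | absent ev v w (≢not (trans (shade-off u uv-vw uw-vw) pulled-vw))
        | uv-vw | uw-vw | ε-refl v≢w = refl
      -- The edge `uv` lies in `D` although its pulled-back colour is not controlled; this is
      -- harmless because it disappears in `H`.
      Allowed : Rel (n G)
      Allowed x y = Adj G x y × (ε u v x y ≡ true ⊎ pulled x y ≡ not c₀)
      not-uw : ∀ {x y} → D x y ≡ true → ε u w x y ≡ true → ⊥
      not-uw {x} {y} h k with ε-support u w x y k
      ... | inj₁ (refl , refl) = contra h D-uw
      ... | inj₂ (refl , refl) = contra (trans (D-sym u w) h) D-uw
      not-vw : ∀ {x y} → D x y ≡ true → ε v w x y ≡ true → ⊥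
      not-vw {x} {y} h k with ε-support v w x y k
      ... | inj₁ (refl , refl) = contra h D-vw
      ... | inj₂ (refl , refl) = contra (trans (D-sym v w) h) D-vw
      D-support : ∀ x y → D x y ≡ true → Allowed x y
      D-support x y h with ε u v x y Bool.≟ true
      ... | yes k with ε-support u v x y k
      ...   | inj₁ (refl , refl) = u~v , inj₁ k
      ...   | inj₂ (refl , refl) = adj-sym G u~v , inj₁ k
      D-support x y h | no ne with xor-true (E x y) (E′ x y) (trans (sym (trans
          (cong ((E x y xor E′ x y) xor_) (cong₂ _xor_ e₁ (cong₂ _xor_ e₂ e₃))) (Bool.xor-identityʳ _))) h)
        where
        e₁ = Bool.¬-not ne
        e₂ = Bool.¬-not (not-uw {x} {y} h)
        e₃ = Bool.¬-not (not-vw {x} {y} h)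
      ... | inj₁ k = let (a , e) = EvenIn.support ev x y k in
                     a , inj₂ (trans (sym (shade-off u (Bool.¬-not ne) (Bool.¬-not (not-uw {x} {y} h)))) e)
      ... | inj₂ k = let (a , e) = EvenIn.support ev′ x y k in
                     a , inj₂ (trans (sym (shade-off v (Bool.¬-not ne) (Bool.¬-not (not-vw {x} {y} h)))) e)
      sum-even : EvenIn Allowed D
      sum-even = record { symmetric = D-sym ; even = D-rows ; support = D-support ; edge = u , v , D-uv }
      to-class : ∀ {x y} → D x y ≡ true → q x ≢ q y → Class H κ (not c₀) (q x) (q y)
      to-class {x} {y} h ne with D-support x y h
      ... | a , inj₁ k = ⊥-elim (not-one ne k)
      ... | a , inj₂ k = q-adj a ne , k

  contract-mono : MonoCycle H κ
  contract-mono with any? (λ w → adj? G u w ×-dec adj? G v w)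
  ... | no none = no-triangle λ a b → none (_ , a , b)
  ... | yes (w , uw , vw) with mono⇒even (RG (shading uw vw u)) | mono⇒even (RG (shading uw vw v))
  ...   | c , E , ev | c′ , E′ , ev′ with E u w in eq | E′ v w in eq′
  ...     | false | _     = avoiding uw vw (inj₁ refl) ev eq
  ...     | true  | false = avoiding uw vw (inj₂ refl) ev′ eq′
  ...     | true  | true  = both uw vw ev ev′ eq eq′

contract-ramsey : ∀ G → Ramsey G → ∀ u v (e : Adj G u v) → AtMostOneTriangle G u v → Ramsey (contract G u v e)
contract-ramsey G RG u v e few κ = contract-mono (projection G u v e) e few RG κ

-- Counting edges

module ∑ = FiniteSum ℕ.+-0-commutativeMonoid

∑-mono : ∀ {k} {f g : Fin k → ℕ} → (∀ i → f i ≤ g i) → ∑.sum f ≤ ∑.sum g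
∑-mono {zero}  h = z≤n
∑-mono {suc k} h = ℕ.+-mono-≤ (h zero) (∑-mono (h ∘ suc))

∑-mono-< : ∀ {k} {f g : Fin k → ℕ} → (∀ i → f i ≤ g i) → ∀ x → f x < g x → ∑.sum f < ∑.sum g
∑-mono-< h zero    lt = ℕ.+-mono-<-≤ lt (∑-mono (h ∘ suc))
∑-mono-< h (suc x) lt = ℕ.+-mono-≤-< (h zero) (∑-mono-< (h ∘ suc) x lt)

∑-zero : ∀ {k} {f : Fin k → ℕ} → (∀ i → f i ≡ 0) → ∑.sum f ≡ 0
∑-zero {zero}  h = refl
∑-zero {suc k} h rewrite h zero = ∑-zero (h ∘ suc)

∑-const : ∀ k c → ∑.sum {k} (λ _ → c) ≡ k * c
∑-const zero    c = refl
∑-const (suc k) c = cong (c +_) (∑-const k c)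

⟦_⟧ : ∀ {P : Set} → Dec P → ℕ
⟦ d ⟧ = if does d then 1 else 0

⟦⟧-yes : ∀ {P : Set} (d : Dec P) → P → ⟦ d ⟧ ≡ 1
⟦⟧-yes (yes _) p = refl
⟦⟧-yes (no np) p = ⊥-elim (np p)

⟦⟧-no : ∀ {P : Set} (d : Dec P) → ¬ P → ⟦ d ⟧ ≡ 0
⟦⟧-no (yes p) np = ⊥-elim (np p)
⟦⟧-no (no _)  np = refl

⟦⟧-mono : ∀ {P Q : Set} (p : Dec P) (q : Dec Q) → (P → Q) → ⟦ p ⟧ ≤ ⟦ q ⟧
⟦⟧-mono (no _)  q f = z≤n
⟦⟧-mono (yes p) q f = ℕ.≤-reflexive (sym (⟦⟧-yes q (f p)))

⟦⟧-cover : ∀ {P Q R : Set} (p : Dec P) (q : Dec Q) (r : Dec R) → (P → Q ⊎ R) → ⟦ p ⟧ ≤ ⟦ q ⟧ + ⟦ r ⟧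
⟦⟧-cover (no _) q r f = z≤n
⟦⟧-cover (yes p) q r f with f p
... | inj₁ h = ℕ.m≤n⇒m≤n+o ⟦ r ⟧ (ℕ.≤-reflexive (sym (⟦⟧-yes q h)))
... | inj₂ h = ℕ.m≤n⇒m≤o+n ⟦ q ⟧ (ℕ.≤-reflexive (sym (⟦⟧-yes r h)))

⟦⟧-pack : ∀ {P Q R : Set} (p : Dec P) (q : Dec Q) (r : Dec R) →
          (P → R) → (Q → R) → (P → ¬ Q) → ⟦ p ⟧ + ⟦ q ⟧ ≤ ⟦ r ⟧
⟦⟧-pack (no _)  q       r f g h = ⟦⟧-mono q r g
⟦⟧-pack (yes p) (yes q) r f g h = ⊥-elim (h p q)
⟦⟧-pack (yes p) (no _)  r f g h = ℕ.≤-reflexive (sym (⟦⟧-yes r (f p)))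

count : ∀ {N} {P : Fin N → Set} → (∀ x → Dec (P x)) → ℕ
count P? = ∑.sum (λ x → ⟦ P? x ⟧)

count-mono : ∀ {N} {P Q : Fin N → Set} (P? : ∀ x → Dec (P x)) (Q? : ∀ x → Dec (Q x)) →
             (∀ x → P x → Q x) → count P? ≤ count Q?
count-mono P? Q? f = ∑-mono λ x → ⟦⟧-mono (P? x) (Q? x) (f x)

count-cover : ∀ {N} {P Q R : Fin N → Set} (P? : ∀ x → Dec (P x)) (Q? : ∀ x → Dec (Q x)) (R? : ∀ x → Dec (R x)) →
              (∀ x → P x → Q x ⊎ R x) → count P? ≤ count Q? + count R?
count-cover P? Q? R? f = ℕ.≤-trans (∑-mono λ x → ⟦⟧-cover (P? x) (Q? x) (R? x) (f x))
                                   (ℕ.≤-reflexive (∑.∑-distrib-+ (λ x → ⟦ Q? x ⟧) (λ x → ⟦ R? x ⟧)))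

count-pack : ∀ {N} {P Q R : Fin N → Set} (P? : ∀ x → Dec (P x)) (Q? : ∀ x → Dec (Q x)) (R? : ∀ x → Dec (R x)) →
             (∀ x → P x → R x) → (∀ x → Q x → R x) → (∀ x → P x → ¬ Q x) → count P? + count Q? ≤ count R?
count-pack P? Q? R? f g h = ℕ.≤-trans (ℕ.≤-reflexive (sym (∑.∑-distrib-+ (λ x → ⟦ P? x ⟧) (λ x → ⟦ Q? x ⟧))))
                                      (∑-mono λ x → ⟦⟧-pack (P? x) (Q? x) (R? x) (f x) (g x) (h x))

count-≡ : ∀ {N} (x : Fin N) → count (_≟ x) ≡ 1
count-≡ {suc N} zero    = cong suc (∑-zero {N} λ _ → refl)
count-≡ {suc N} (suc x) = count-≡ x

_except_ : ∀ {N} {P : Fin N → Set} → (∀ y → Dec (P y)) → ∀ x y → Dec (P y × y ≢ x)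
(P? except x) y = P? y ×-dec ¬? (y ≟ x)

count-except-≤ : ∀ {N} {P : Fin N → Set} (P? : ∀ y → Dec (P y)) x → count P? ≤ suc (count (P? except x))
count-except-≤ P? x = subst (λ t → count P? ≤ t + count (P? except x)) (count-≡ x)
  (count-cover P? (_≟ x) (P? except x) split)
  where
  split : ∀ y → _ → y ≡ x ⊎ _
  split y p with y ≟ x
  ... | yes e = inj₁ e
  ... | no ne = inj₂ (p , ne)

count-except-< : ∀ {N} {P : Fin N → Set} (P? : ∀ y → Dec (P y)) x → P x → count (P? except x) < count P?
count-except-< P? x px = subst (λ t → t + count (P? except x) ≤ count P?) (count-≡ x)
  (count-pack (_≟ x) (P? except x) P? (λ { y refl → px }) (λ _ → proj₁) (λ { y e (_ , ne) → ne e }))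

count-≥ : ∀ {N} {P : Fin N → Set} (P? : ∀ y → Dec (P y)) {xs} → Unique xs → All P xs → length xs ≤ count P?
count-≥ P? [] [] = z≤n
count-≥ P? {x ∷ xs} (x≢ ∷ u) (px ∷ ps) = ℕ.≤-trans
  (s≤s (count-≥ (P? except x) u (All.zip (ps , All.map (_∘ sym) x≢))))
  (count-except-< P? x px)

count-witness : ∀ {N} {P : Fin N → Set} (P? : ∀ y → Dec (P y)) xs → length xs < count P? →
                ∃ λ y → P y × All (y ≢_) xs
count-witness {N} P? [] lt with any? P?
... | yes (y , p) = y , p , []
... | no none     = ⊥-elim (ℕ.n≮n 0 (subst (0 <_) (∑-zero {N} λ y → ⟦⟧-no (P? y) λ p → none (y , p)) lt))
count-witness P? (x ∷ xs) lt with count-witness (P? except x) xs (s≤s⁻¹ (ℕ.≤-trans lt (count-except-≤ P? x)))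
... | y , (p , ne) , away = y , p , ne ∷ away

count-≤ : ∀ {N} {P : Fin N → Set} (P? : ∀ y → Dec (P y)) xs → (∀ y → P y → ¬ All (y ≢_) xs) → count P? ≤ length xs
count-≤ P? xs cover = ℕ.≮⇒≥ λ lt → let (y , p , away) = count-witness P? xs lt in cover y p away

-- Degree sums that force cycles

deg : (G : Graph) → Fin (n G) → ℕ
deg G x = count (adj? G x)

degree-sum : Graph → ℕ
degree-sum G = ∑.sum (deg G)

map-cycle : ∀ {M N} {R : Rel M} {R′ : Rel N} (f : Fin M → Fin N) → Injective _≡_ _≡_ f →
            (∀ {x y} → R x y → R′ (f x) (f y)) → Cycle R → Cycle R′
map-cycle f f-inj g C = record
  { excess = excess ; vertex = f ∘ vertex ; distinct = distinct ∘ f-inj ; steps = g ∘ steps ; closes = g closes }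
  where open Cycle C

-- Deleting a vertex with at most one neighbour costs at most two in the degree sum; once none is
-- left, `R` itself is a core. The bound is twice the number of vertices less one, which is what
-- splitting a degree sum of `4n - 2` between two colours provides.
many-edges⇒cycle : ∀ N (R : Rel (suc N)) (R? : ∀ x y → Dec (R x y)) → Symm R → (∀ {x} → ¬ R x x) →
                   suc N + suc N ≤ suc (∑.sum λ x → count (R? x)) → Cycle R
many-edges⇒cycle N R R? R-sym irr le
  -- Isolated vertices count as leaves too, with any `u`.
  with any? (λ x → any? (λ u → all? (λ w → R? x w →-dec (w ≟ u))))
... | no noleaf = core⇒cycle irr record
  { _∼_ = R ; ∼-sym = R-sym ; ∼⇒R = λ r → r
  ; edge = zero , proj₁ (another zero zero) , proj₂ (proj₂ (another zero zero))
  ; branch = λ {x} {y} _ → another x y }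
  where
  another : ∀ x u → ∃ λ z → z ≢ u × R x z
  another x u with any? (λ z → ¬? (z ≟ u) ×-dec R? x z)
  ... | yes found = found
  ... | no none = ⊥-elim (noleaf (x , u , λ w r → decidable-stable (w ≟ u) λ ne → none (w , ne , r)))
many-edges⇒cycle zero R R? R-sym irr le | yes _
  rewrite ⟦⟧-no (R? zero zero) irr = ⊥-elim (ℕ.1+n≰n le)
many-edges⇒cycle (suc N) R R? R-sym irr le | yes (x , u , leaf) =
  map-cycle {R = R′} (punchIn x) (punchIn-injective x _ _) (λ r → r)
    (many-edges⇒cycle N R′ (λ i j → R? (punchIn x i) (punchIn x j)) R-sym irr bound)
  where
  R′ : Rel (suc N)
  R′ i j = R (punchIn x i) (punchIn x j)
  total′ : ℕ
  total′ = ∑.sum λ i → count λ j → R? (punchIn x i) (punchIn x j)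
  row : count (R? x) ≤ 1
  row = ℕ.≤-trans (count-mono (R? x) (_≟ u) leaf) (ℕ.≤-reflexive (count-≡ u))
  column : ∑.sum (λ i → ⟦ R? (punchIn x i) x ⟧) ≤ 1
  column = ℕ.≤-trans (ℕ.m≤n+m _ ⟦ R? x x ⟧) (ℕ.≤-trans (ℕ.≤-reflexive (sym (∑.sum-remove {i = x} (λ y → ⟦ R? y x ⟧))))
             (ℕ.≤-trans (count-mono (λ y → R? y x) (R? x) (λ _ → R-sym)) row))
  total : ∑.sum (λ y → count (R? y)) ≤ 1 + (1 + total′)
  total = begin
    ∑.sum (λ y → count (R? y)) ≡⟨ ∑.sum-remove {i = x} (λ y → count (R? y)) ⟩
    count (R? x) + ∑.sum (λ i → count (R? (punchIn x i)))
      ≡⟨ cong (count (R? x) +_) (trans (∑.sum-cong-≗ λ i → ∑.sum-remove {i = x} (λ y → ⟦ R? (punchIn x i) y ⟧))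
                                       (∑.∑-distrib-+ (λ i → ⟦ R? (punchIn x i) x ⟧)
                                                       (λ i → count λ j → R? (punchIn x i) (punchIn x j)))) ⟩
    count (R? x) + (∑.sum (λ i → ⟦ R? (punchIn x i) x ⟧) + total′) ≤⟨ ℕ.+-mono-≤ row (ℕ.+-monoˡ-≤ total′ column) ⟩
    1 + (1 + total′) ∎
    where open ℕ.≤-Reasoning
  bound : suc N + suc N ≤ suc total′
  bound = s≤s⁻¹ (s≤s⁻¹ (subst (_≤ 3 + total′) (cong suc (ℕ.+-suc (suc N) (suc N))) (ℕ.≤-trans le (s≤s total))))

class? : ∀ G κ c x y → Dec (Class G κ c x y)
class? G κ c x y = adj? G x y ×-dec (col κ x y Bool.≟ c)

class-irrefl : ∀ G κ c {x} → ¬ Class G κ c x x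
class-irrefl G κ c = irrefl G ∘ proj₁

class-sum : ∀ G → Colouring G → Bool → ℕ
class-sum G κ c = ∑.sum λ x → count (class? G κ c x)

double : ℕ → ℕ
double k = k + k

-- The two colour classes have degree sums adding up to at least `4n - 2`, so one of them reaches
-- `2n - 1`.
many-edges⇒ramsey : ∀ G → 0 < n G → double (double (n G)) ≤ 2 + degree-sum G → Ramsey G
many-edges⇒ramsey G@(record { n = suc N }) _ le κ with double (suc N) ℕ.≤? suc (class-sum G κ true)
... | yes t = cycle⇒mono (many-edges⇒cycle N _ (class? G κ true) (class-sym G κ true) (class-irrefl G κ true) t)
... | no f = cycle⇒mono (many-edges⇒cycle N _ (class? G κ false) (class-sym G κ false) (class-irrefl G κ false) enough)
  where
  split : ∀ x y → Adj G x y → Class G κ true x y ⊎ Class G κ false x y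
  split x y a with col κ x y
  ... | true  = inj₁ (a , refl)
  ... | false = inj₂ (a , refl)
  total : degree-sum G ≤ class-sum G κ true + class-sum G κ false
  total = ℕ.≤-trans (∑-mono λ x → count-cover (adj? G x) (class? G κ true x) (class? G κ false x) (split x))
                    (ℕ.≤-reflexive (∑.∑-distrib-+ (λ x → count (class? G κ true x)) (λ x → count (class? G κ false x))))
  enough : double (suc N) ≤ suc (class-sum G κ false)
  enough = ℕ.≤-trans (ℕ.+-cancelˡ-≤ (double (suc N)) _ _ (begin
    double (double (suc N))                            ≤⟨ le ⟩
    2 + degree-sum G                                   ≤⟨ ℕ.+-monoʳ-≤ 2 total ⟩
    2 + class-sum G κ true + class-sum G κ false               ≤⟨ ℕ.+-monoˡ-≤ (class-sum G κ false) (ℕ.≰⇒> f) ⟩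
    double (suc N) + class-sum G κ false                   ∎)) (ℕ.n≤1+n _)
    where open ℕ.≤-Reasoning

-- Subgraphs

delete-edge : (G : Graph) (u v : Fin (n G)) → Graph
delete-edge G u v = record
  { n = n G
  ; Adj = λ x y → Adj G x y × ¬ OneOf u v x y
  ; adj? = λ x y → adj? G x y ×-dec ¬? (((x ≟ u) ×-dec (y ≟ v)) ⊎-dec ((x ≟ v) ×-dec (y ≟ u)))
  ; adj-sym = λ { (a , ne) → adj-sym G a , λ { (inj₁ (p , q)) → ne (inj₂ (q , p)) ; (inj₂ (p , q)) → ne (inj₁ (q , p)) } }
  ; irrefl = irrefl G ∘ proj₁
  }

delete-edge-proper : ∀ G {u v} → Adj G u v → ProperSubgraph (delete-edge G u v) G
delete-edge-proper G {u} {v} a = record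
  { sub    = record { emb = λ x → x ; inj = λ e → e ; pres = proj₁ }
  ; proper = inj₂ (u , v , a , λ { (_ , _ , refl , refl , _ , ne) → ne (inj₁ (refl , refl)) })
  }

delete-edge-sum-< : ∀ G {u v} → Adj G u v → degree-sum (delete-edge G u v) < degree-sum G
delete-edge-sum-< G {u} {v} a = ∑-mono-< (λ x → count-mono (adj? (delete-edge G u v) x) (adj? G x) (λ _ → proj₁)) u
  (ℕ.≤-trans (s≤s (count-mono (adj? (delete-edge G u v) u) (adj? G u except v)
                    λ { y (b , ne) → b , λ { refl → ne (inj₁ (refl , refl)) } }))
             (count-except-< (adj? G u) v a))

delete-edge-sum-≥ : ∀ G {u v} → Adj G u v → degree-sum G ≤ 2 + degree-sum (delete-edge G u v)
delete-edge-sum-≥ G {u} {v} a = begin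
  degree-sum G ≤⟨ ∑-mono row ⟩
  ∑.sum (λ x → ⟦ x ≟ u ⟧ + (⟦ x ≟ v ⟧ + deg H x)) ≡⟨ ∑.∑-distrib-+ (λ x → ⟦ x ≟ u ⟧) _ ⟩
  count (_≟ u) + ∑.sum (λ x → ⟦ x ≟ v ⟧ + deg H x) ≡⟨ cong₂ _+_ (count-≡ u) (∑.∑-distrib-+ (λ x → ⟦ x ≟ v ⟧) (deg H)) ⟩
  1 + (count (_≟ v) + degree-sum H) ≡⟨ cong (λ t → suc (t + degree-sum H)) (count-≡ v) ⟩
  2 + degree-sum H ∎
  where
  open ℕ.≤-Reasoning
  H = delete-edge G u v
  row : ∀ x → deg G x ≤ ⟦ x ≟ u ⟧ + (⟦ x ≟ v ⟧ + deg H x)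
  row x = by-cases (x ≟ u) (x ≟ v)
    where
    by-cases : (d : Dec (x ≡ u)) (e : Dec (x ≡ v)) → deg G x ≤ ⟦ d ⟧ + (⟦ e ⟧ + deg H x)
    by-cases (yes refl) (yes refl) = ⊥-elim (irrefl G a)
    by-cases (yes refl) (no _) = ℕ.≤-trans (count-except-≤ (adj? G u) v)
      (s≤s (count-mono (adj? G u except v) (adj? H u)
        λ { y (b , ne) → b , λ { (inj₁ (_ , e)) → ne e ; (inj₂ (refl , _)) → irrefl G a } }))
    by-cases (no _) (yes refl) = ℕ.≤-trans (count-except-≤ (adj? G v) u)
      (s≤s (count-mono (adj? G v except u) (adj? H v)
        λ { y (b , ne) → b , λ { (inj₁ (refl , _)) → irrefl G a ; (inj₂ (_ , e)) → ne e } }))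
    by-cases (no x≢u) (no x≢v) = count-mono (adj? G x) (adj? H x)
      λ y b → b , λ { (inj₁ (e , _)) → x≢u e ; (inj₂ (e , _)) → x≢v e }

-- Packages `punchIn` so that a vertex can be removed from any `G` without presenting `n G` as a
-- successor.
record Complement {N : ℕ} (x : Fin N) : Set where
  field
    size   : ℕ
    size-suc : suc size ≡ N
    emb    : Fin size → Fin N
    inj    : Injective _≡_ _≡_ emb
    avoids : ∀ i → emb i ≢ x
    covers : ∀ y → x ≢ y → ∃ λ i → emb i ≡ y

complement : ∀ {N} (x : Fin N) → Complement x
complement {suc N} x = record
  { size = N ; size-suc = refl ; emb = punchIn x ; inj = punchIn-injective x _ _ ; avoids = punchInᵢ≢i x
  ; covers = λ y ne → punchOut ne , punchIn-punchOut ne }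

delete-vertex : (G : Graph) → Fin (n G) → Graph
delete-vertex G x = record
  { n = size ; Adj = λ i j → Adj G (emb i) (emb j) ; adj? = λ i j → adj? G (emb i) (emb j)
  ; adj-sym = adj-sym G ; irrefl = irrefl G }
  where open Complement (complement x)

delete-vertex-proper : ∀ G x → ProperSubgraph (delete-vertex G x) G
delete-vertex-proper G x = record
  { sub = record { emb = emb ; inj = inj ; pres = λ a → a } ; proper = inj₁ (x , avoids) }
  where open Complement (complement x)

⊆-refl : ∀ {G} → G ⊆ G
⊆-refl = record { emb = λ x → x ; inj = λ e → e ; pres = λ a → a }

⊆-trans : ∀ {G H K} → G ⊆ H → H ⊆ K → G ⊆ K
⊆-trans f g = record
  { emb = G.emb ∘ F.emb ; inj = F.inj ∘ G.inj ; pres = G.pres ∘ F.pres }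
  where
  module F = _⊆_ f
  module G = _⊆_ g

ramsey-mono : ∀ {H G} → H ⊆ G → Ramsey H → Ramsey G
ramsey-mono {H} {G} f RH κ = cycle⇒mono (map-cycle emb inj (λ (a , e) → pres a , e) (mono⇒cycle C))
  where
  open _⊆_ f
  κ′ : Colouring H
  κ′ = record { col = λ x y → col κ (emb x) (emb y) ; col-sym = λ x y → col-sym κ (emb x) (emb y) }
  C : MonoCycle H κ′
  C = RH κ′

-- The vertex or edge missed by `H` can be deleted from `G` around it. With `ramsey-mono`,
-- minimality thus reduces to finitely many single deletions.
proper⇒deletion : ∀ {H G} → ProperSubgraph H G →
  (∃ λ x → H ⊆ delete-vertex G x) ⊎ (∃ λ u → ∃ λ v → Adj G u v × H ⊆ delete-edge G u v)
proper⇒deletion {H} {G} record { sub = f ; proper = inj₁ (x , missed) } = inj₁ (x , record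
  { emb  = proj₁ ∘ pre
  ; inj  = λ {a} {b} e → inj (trans (sym (proj₂ (pre a))) (trans (cong C.emb e) (proj₂ (pre b))))
  ; pres = λ {a} {b} h → subst₂ (Adj G) (sym (proj₂ (pre a))) (sym (proj₂ (pre b))) (pres h)
  })
  where
  open _⊆_ f
  module C = Complement (complement x)
  pre : ∀ a → ∃ λ i → C.emb i ≡ emb a
  pre a = C.covers (emb a) (missed a ∘ sym)
proper⇒deletion {H} {G} record { sub = f ; proper = inj₂ (u , v , uv , missed) } = inj₂ (u , v , uv , record
  { emb  = emb
  ; inj  = inj
  ; pres = λ {a} {b} h → pres h , λ { (inj₁ (p , q)) → missed (a , b , p , q , h)
                                    ; (inj₂ (p , q)) → missed (b , a , q , p , adj-sym H h) }
  })
  where open _⊆_ f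

-- Deciding the Ramsey property

-- Enumeration reaches a function only up to pointwise equality, so the predicate has to respect
-- `_≈_`.
Search : (A : Set) → (A → A → Set) → Set₁
Search A _≈_ = ∀ {P : A → Set} → (∀ {a b} → a ≈ b → P a → P b) → (∀ a → Dec (P a)) → Dec (∃ P)

search-Bool : Search Bool _≡_
search-Bool respects P? = map′ (λ { (inj₁ p) → true , p ; (inj₂ p) → false , p })
  (λ { (true , p) → inj₁ p ; (false , p) → inj₂ p }) (P? true ⊎-dec P? false)

search-Fin : ∀ {N} → Search (Fin N) _≡_
search-Fin respects P? = any? P?

search-→ : ∀ {A : Set} {_≈_ : A → A → Set} → (∀ {a} → a ≈ a) → Search A _≈_ →
           ∀ k → Search (Fin k → A) (λ f g → ∀ i → f i ≈ g i)
search-→ {A} rfl s zero respects P? = map′ (λ p → empty , p) (λ (f , p) → respects (λ ()) p) (P? empty)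
  where
  empty : Fin 0 → A
  empty ()
search-→ rfl s (suc k) respects P? =
  map′ (λ (a , f , p) → a Vector.∷ f , p)
       (λ (f , p) → f zero , f ∘ suc , respects (λ { zero → rfl ; (suc i) → rfl }) p)
       (s (λ a≈b (f , p) → f , respects (λ { zero → a≈b ; (suc i) → rfl }) p)
          λ a → search-→ rfl s k (λ f≈g → respects λ { zero → rfl ; (suc i) → f≈g i }) (λ f → P? (a Vector.∷ f)))

search-Matrix : ∀ N → Search (Matrix N) (λ E F → ∀ i j → E i j ≡ F i j)
search-Matrix N = search-→ (λ j → refl) (search-→ refl search-Bool N) N

even? : ∀ {N} {R : Rel N} → (∀ x y → Dec (R x y)) → Dec (∃ (EvenIn R))
even? {N} {R} R? = search-Matrix N respects λ E → map′
  (λ (a , b , c , d) → record { symmetric = a ; even = b ; support = c ; edge = d })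
  (λ ev → let open EvenIn ev in symmetric , even , support , edge)
  (all? (λ x → all? λ y → E x y Bool.≟ E y x) ×-dec all? (λ x → ⊕.sum (E x) Bool.≟ false) ×-dec
   all? (λ x → all? λ y → (E x y Bool.≟ true) →-dec R? x y) ×-dec any? (λ x → any? λ y → E x y Bool.≟ true))
  where
  respects : ∀ {E F : Matrix N} → (∀ i j → E i j ≡ F i j) → EvenIn R E → EvenIn R F
  respects eq ev = let open EvenIn ev in record
    { symmetric = λ x y → trans (sym (eq x y)) (trans (symmetric x y) (eq y x))
    ; even      = λ x → trans (sym (⊕.sum-cong-≗ (eq x))) (even x)
    ; support   = λ x y h → support x y (trans (eq x y) h)
    ; edge      = let (x , y , h) = edge in x , y , trans (sym (eq x y)) h
    }

even-mono : ∀ {N} {R R′ : Rel N} → (∀ {x y} → R x y → R′ x y) → ∃ (EvenIn R) → ∃ (EvenIn R′)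
even-mono f (E , ev) = E , record
  { symmetric = symmetric ; even = even ; support = λ x y h → f (support x y h) ; edge = edge }
  where open EvenIn ev

-- Cycles come with varying lengths, even subgraphs as Boolean matrices of one fixed size; so the
-- latter are searched.
monoCycle? : ∀ G κ → Dec (MonoCycle G κ)
monoCycle? G κ = map′ (λ (c , E , ev) → core⇒mono c (even⇒core ev)) mono⇒even
  (search-Bool (λ { refl h → h }) λ c → even? (class? G κ c))

-- The search is for a symmetric colour matrix without an even subgraph in either colour.
-- Decidability makes minimal Ramsey subgraphs constructible.
ramsey? : ∀ G → Dec (Ramsey G)
ramsey? G = map′ from to (¬? (search-Matrix (n G) respects bad?))
  where
  Colours : Matrix (n G) → Bool → Rel (n G)
  Colours f c x y = Adj G x y × f x y ≡ c
  Bad : Matrix (n G) → Set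
  Bad f = (∀ x y → f x y ≡ f y x) × (∀ c → ¬ ∃ (EvenIn (Colours f c)))
  respects : ∀ {f g} → (∀ x y → f x y ≡ g x y) → Bad f → Bad g
  respects eq (s , h) = (λ x y → trans (sym (eq x y)) (trans (s x y) (eq y x))) ,
    λ c e → h c (even-mono (λ (a , k) → a , trans (eq _ _) k) e)
  bad? : ∀ f → Dec (Bad f)
  bad? f = all? (λ x → all? λ y → f x y Bool.≟ f y x) ×-dec
    map′ (λ (h , k) → λ { true → h ; false → k }) (λ h → h true , h false) (good? true ×-dec good? false)
    where
    good? : ∀ c → Dec (¬ ∃ (EvenIn (Colours f c)))
    good? c = ¬? (even? λ x y → adj? G x y ×-dec (f x y Bool.≟ c))
  from : ¬ ∃ Bad → Ramsey G
  from h κ = decidable-stable (monoCycle? G κ) λ none →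
    h (col κ , col-sym κ , λ c (E , ev) → none (core⇒mono c (even⇒core ev)))
  to : Ramsey G → ¬ ∃ Bad
  to RG (f , s , h) = let (c , e) = mono⇒even (RG record { col = f ; col-sym = s }) in h c e

_⊆?_ : ∀ H G → Dec (H ⊆ G)
H ⊆? G = map′
  (λ (f , i , p) → record { emb = f ; inj = i _ _ ; pres = p _ _ })
  (λ f → let open _⊆_ f in emb , (λ _ _ → inj) , (λ _ _ → pres))
  (search-→ refl search-Fin (n H)
    (λ {f} {g} eq (i , p) → (λ a b e → i a b (trans (eq a) (trans e (sym (eq b))))) ,
                            (λ a b h → subst₂ (Adj G) (eq a) (eq b) (p a b h)))
    λ f → all? (λ a → all? λ b → (f a ≟ f b) →-dec (a ≟ b)) ×-dec
          all? (λ a → all? λ b → adj? H a b →-dec adj? G (f a) (f b)))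

-- Vertices and edges are deleted while the Ramsey property survives; vertex number and degree sum
-- decrease lexicographically.
minimal-subgraph : ∀ {G} → Ramsey G → ∃ λ H → H ⊆ G × Minimal H
minimal-subgraph {G} RG = go (n G) (degree-sum G) G refl ℕ.≤-refl RG
  where
  go : ∀ k d G → n G ≡ k → degree-sum G ≤ d → Ramsey G → ∃ λ H → H ⊆ G × Minimal H
  go k d G n≡k le RG with any? (λ x → ramsey? (delete-vertex G x))
                        | any? (λ u → any? λ v → adj? G u v ×-dec ramsey? (delete-edge G u v))
  go (suc k) d G n≡k le RG | yes (x , r) | _ =
    let (H , f , min) = go k (degree-sum (delete-vertex G x)) (delete-vertex G x)
                          (ℕ.suc-injective (trans (Complement.size-suc (complement x)) n≡k)) ℕ.≤-refl r
    in H , ⊆-trans f (ProperSubgraph.sub (delete-vertex-proper G x)) , min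
  go zero d G refl le RG | yes (() , _) | _
  go k (suc d) G n≡k le RG | no _ | yes (u , v , uv , r) =
    let (H , f , min) = go k d (delete-edge G u v) n≡k (s≤s⁻¹ (ℕ.≤-trans (delete-edge-sum-< G uv) le)) r
    in H , ⊆-trans f (ProperSubgraph.sub (delete-edge-proper G uv)) , min
  go k zero G n≡k le RG | no _ | yes (u , v , uv , r) with ℕ.≤-trans (delete-edge-sum-< G uv) le
  ... | ()
  go k d G n≡k le RG | no no-v | no no-e = G , ⊆-refl , RG , λ H proper RH → critical RH (proper⇒deletion proper)
    where
    critical : ∀ {H} → Ramsey H →
      ¬ ((∃ λ x → H ⊆ delete-vertex G x) ⊎ (∃ λ u → ∃ λ v → Adj G u v × H ⊆ delete-edge G u v))
    critical RH (inj₁ (x , f))          = no-v (x , ramsey-mono f RH)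
    critical RH (inj₂ (u , v , uv , f)) = no-e (u , v , uv , ramsey-mono f RH)

-- A vertex or edge outside the image would make `H` a proper Ramsey subgraph.
minimal-iso : ∀ {H G} → Minimal G → Ramsey H → H ⊆ G → G ≅ H
minimal-iso {H} {G} (RG , crit) RH f = record
  { to      = proj₁ ∘ pre
  ; from    = emb
  ; from∘to = proj₂ ∘ pre
  ; to∘from = λ j → inj (proj₂ (pre (emb j)))
  ; pres    = λ {i} {j} a → reflects (subst₂ (Adj G) (sym (proj₂ (pre i))) (sym (proj₂ (pre j))) a)
  ; refl'   = λ {i} {j} h → subst₂ (Adj G) (proj₂ (pre i)) (proj₂ (pre j)) (pres h)
  }
  where
  open _⊆_ f
  pre : ∀ x → ∃ λ a → emb a ≡ x
  pre x with any? (λ a → emb a ≟ x)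
  ... | yes found = found
  ... | no missed = ⊥-elim (crit H record { sub = f ; proper = inj₁ (x , λ a e → missed (a , e)) } RH)
  reflects : ∀ {a b} → Adj G (emb a) (emb b) → Adj H a b
  reflects {a} {b} h = decidable-stable (adj? H a b) λ nh → crit H record
    { sub = f ; proper = inj₂ (emb a , emb b , h , λ (a′ , b′ , e , e′ , h′) →
        nh (subst₂ (Adj H) (inj e) (inj e′) h′)) } RH

some-vertex : ∀ {G} → Ramsey G → Fin (n G)
some-vertex RG = MonoCycle.v (RG record { col = λ _ _ → true ; col-sym = λ _ _ → refl }) zero

some-edge : ∀ {G} → Ramsey G → ∃ λ u → ∃ λ v → Adj G u v
some-edge RG = _ , _ , proj₁ (MonoCycle.close (RG record { col = λ _ _ → true ; col-sym = λ _ _ → refl }))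

-- From degree sum `4n` on, deleting an edge leaves at least `4n - 2`, which still forces the Ramsey
-- property.
minimal-sparse : ∀ {G} → Minimal G → degree-sum G < double (double (n G))
minimal-sparse {G} (RG , crit) = ℕ.≰⇒> λ le → let (u , v , a) = some-edge RG in
  crit (delete-edge G u v) (delete-edge-proper G a)
    (many-edges⇒ramsey (delete-edge G u v) (nonempty (some-vertex RG)) (ℕ.≤-trans le (delete-edge-sum-≥ G a)))
  where
  nonempty : ∀ {k} → Fin k → 0 < k
  nonempty {suc k} _ = s≤s z≤n

-- Graphs all of whose edges lie in two triangles

fromEdges-⊆ : ∀ {G N es} (xs : Vec (Fin (n G)) N) → Vec.Unique xs →
              All (λ e → Adj G (lookup xs (proj₁ e)) (lookup xs (proj₂ e))) es → fromEdges N es ⊆ G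
fromEdges-⊆ {G} xs unique adjs = record
  { emb  = lookup xs
  ; inj  = lookup-injective unique _ _
  ; pres = λ { (_ , inj₁ e) → find adjs e ; (_ , inj₂ e) → adj-sym G (find adjs e) }
  }
  where
  find : ∀ {es i j} → All (λ e → Adj G (lookup xs (proj₁ e)) (lookup xs (proj₂ e))) es →
         Any (λ e → proj₁ e ≡ i × proj₂ e ≡ j) es → Adj G (lookup xs i) (lookup xs j)
  find (a ∷ _)  (here (refl , refl)) = a
  find (_ ∷ as) (there e)            = find as e

-- An isolated vertex lies on no cycle, so deleting it would keep the Ramsey property.
no-isolated : ∀ {G} → Minimal G → ∀ x → ∃ (Adj G x)
no-isolated {G} (RG , crit) x with any? (adj? G x)
... | yes found = found
... | no isolated = ⊥-elim (crit (delete-vertex G x) (delete-vertex-proper G x) ramsey)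
  where
  open Complement (complement x)
  H = delete-vertex G x
  paint : Colouring H → ∀ {y z} → Dec (x ≡ y) → Dec (x ≡ z) → Bool
  paint κ {y} {z} (no p) (no q) = col κ (proj₁ (covers y p)) (proj₁ (covers z q))
  -- An arbitrary colour for pairs containing `x`, none of which is an edge.
  paint κ _ _ = true
  paint-sym : ∀ κ {y z} (p : Dec (x ≡ y)) (q : Dec (x ≡ z)) → paint κ p q ≡ paint κ q p
  paint-sym κ (no _)  (no _)  = col-sym κ _ _
  paint-sym κ (no _)  (yes _) = refl
  paint-sym κ (yes _) (no _)  = refl
  paint-sym κ (yes _) (yes _) = refl
  paint-emb : ∀ κ i j (p : Dec (x ≡ emb i)) (q : Dec (x ≡ emb j)) → paint κ p q ≡ col κ i j
  paint-emb κ i j (yes e) _       = ⊥-elim (avoids i (sym e))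
  paint-emb κ i j (no _)  (yes e) = ⊥-elim (avoids j (sym e))
  paint-emb κ i j (no p)  (no q)  = cong₂ (col κ) (inj (proj₂ (covers (emb i) p))) (inj (proj₂ (covers (emb j) q)))
  ramsey : Ramsey H
  ramsey κ with mono⇒even (RG record { col = λ y z → paint κ (x ≟ y) (x ≟ z)
                                     ; col-sym = λ y z → paint-sym κ (x ≟ y) (x ≟ z) })
  ... | c , E , ev = core⇒mono c record
    { _∼_    = λ i j → emb i ∼ emb j
    ; ∼-sym  = ∼-sym
    ; ∼⇒R    = λ {i} {j} h → let (a , e) = ∼⇒R h in a , trans (sym (paint-emb κ i j (x ≟ emb i) (x ≟ emb j))) e
    ; edge   = let (y , z , h) = edge
                   (i , e) = covers y (active h) ; (j , f) = covers z (active (∼-sym h))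
               in i , j , subst₂ _∼_ (sym e) (sym f) h
    ; branch = λ {i} {j} h → let (z , ne , k) = branch h
                                 (l , e) = covers z (active (∼-sym k))
                             in l , (λ l≡j → ne (trans (sym e) (cong emb l≡j))) , subst (emb i ∼_) (sym e) k
    }
    where
    open Core (even⇒core ev)
    active : ∀ {y z} → y ∼ z → x ≢ y
    active h refl = isolated (_ , proj₁ (∼⇒R h))

record K4 (G : Graph) (p q r s : Fin (n G)) : Set where
  constructor k4
  field
    pq : Adj G p q
    pr : Adj G p r
    ps : Adj G p s
    qr : Adj G q r
    qs : Adj G q s
    rs : Adj G r s

rotate : ∀ {G p q r s} → K4 G p q r s → K4 G q r s p
rotate {G} (k4 pq pr ps qr qs rs) = k4 qr qs (adj-sym G pq) rs (adj-sym G pr) (adj-sym G ps)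

swap : ∀ {G p q r s} → K4 G p q r s → K4 G p q s r
swap {G} (k4 pq pr ps qr qs rs) = k4 pq ps pr qs qr (adj-sym G rs)

turn : ∀ {G p q r s} → K4 G p q r s → K4 G p r s q
turn {G} (k4 pq pr ps qr qs rs) = k4 pr ps pq rs (adj-sym G qr) (adj-sym G qs)

K5-e-⊆ : ∀ {G p q r s t} → K4 G p q r s → Adj G t p → Adj G t q → Adj G t r → t ≢ s → K5-e ⊆ G
K5-e-⊆ {G} {p} {q} {r} {s} {t} (k4 pq pr ps qr qs rs) tp tq tr t≢s = fromEdges-⊆ (s ∷ t ∷ p ∷ q ∷ r ∷ [])
  (((t≢s ∘ sym) ∷ ne (~ ps) ∷ ne (~ qs) ∷ ne (~ rs) ∷ []) ∷ (ne tp ∷ ne tq ∷ ne tr ∷ []) ∷ (ne pq ∷ ne pr ∷ []) ∷ (ne qr ∷ []) ∷ [] ∷ [])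
  (~ ps ∷ ~ qs ∷ ~ rs ∷ tp ∷ tq ∷ tr ∷ pq ∷ pr ∷ qr ∷ [])
  where
  ~ = adj-sym G
  ne = adj-≢ G

K4∨K4-⊆ : ∀ {G p q r s r′ s′} → K4 G p q r s → K4 G p q r′ s′ →
          r ≢ r′ → r ≢ s′ → s ≢ r′ → s ≢ s′ → K4∨K4 ⊆ G
K4∨K4-⊆ {G} {p} {q} {r} {s} {r′} {s′} (k4 pq pr ps qr qs rs) (k4 _ pr′ ps′ qr′ qs′ r′s′) a b c d =
  fromEdges-⊆ (p ∷ q ∷ r ∷ s ∷ r′ ∷ s′ ∷ [])
  ((ne pq ∷ ne pr ∷ ne ps ∷ ne pr′ ∷ ne ps′ ∷ []) ∷ (ne qr ∷ ne qs ∷ ne qr′ ∷ ne qs′ ∷ []) ∷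
   (ne rs ∷ a ∷ b ∷ []) ∷ (c ∷ d ∷ []) ∷ (ne r′s′ ∷ []) ∷ [] ∷ [])
  (pq ∷ pr ∷ ps ∷ qr ∷ qs ∷ rs ∷ pr′ ∷ ps′ ∷ qr′ ∷ qs′ ∷ r′s′ ∷ [])
  where
  ne = adj-≢ G

-- Colour the K₄ by the red path x a b c and the blue path b x c a: a monochromatic cycle avoids x, a and b,
-- as peeling off leaves shows.
no-pendant-K4 : ∀ {G x a b c} → Minimal G → K4 G x a b c →
  (∀ {y} → Adj G x y → y ≡ a ⊎ y ≡ b ⊎ y ≡ c) → (∀ {y} → Adj G a y → y ≡ x ⊎ y ≡ b ⊎ y ≡ c) →
  (∀ {y} → Adj G b y → y ≡ x ⊎ y ≡ a ⊎ y ≡ c) → ⊥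
no-pendant-K4 {G} {x} {a} {b} {c} (RG , crit) (k4 xa xb xc ab ac bc) Nx Na Nb =
  crit (delete-edge G x a) (delete-edge-proper G xa) ramsey
  where
  x≢a = adj-≢ G xa
  x≢b = adj-≢ G xb
  x≢c = adj-≢ G xc
  a≢b = adj-≢ G ab
  a≢c = adj-≢ G ac
  b≢c = adj-≢ G bc
  Touch : Fin (n G) → Set
  Touch y = y ≡ x ⊎ y ≡ a ⊎ y ≡ b
  touch? : ∀ y → Dec (Touch y)
  touch? y = (y ≟ x) ⊎-dec (y ≟ a) ⊎-dec (y ≟ b)
  oneOf? : ∀ p q y z → Dec (OneOf p q y z)
  oneOf? p q y z = ((y ≟ p) ×-dec (z ≟ q)) ⊎-dec ((y ≟ q) ×-dec (z ≟ p))
  Red : Rel (n G)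
  Red y z = OneOf x a y z ⊎ OneOf a b y z ⊎ OneOf b c y z
  red? : ∀ y z → Dec (Red y z)
  red? y z = oneOf? x a y z ⊎-dec oneOf? a b y z ⊎-dec oneOf? b c y z
  flip : ∀ {p q y z} → OneOf {n G} p q y z → OneOf p q z y
  flip (inj₁ (e , f)) = inj₂ (f , e)
  flip (inj₂ (e , f)) = inj₁ (f , e)
  Red-sym : ∀ {y z} → Red y z → Red z y
  Red-sym (inj₁ h)        = inj₁ (flip h)
  Red-sym (inj₂ (inj₁ h)) = inj₂ (inj₁ (flip h))
  Red-sym (inj₂ (inj₂ h)) = inj₂ (inj₂ (flip h))

  ramsey : Ramsey (delete-edge G x a)
  ramsey κ = restrict (mono⇒even (RG κ′))
    where
    κ′ : Colouring G
    κ′ = record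
      -- All edges of `G` meeting `x`, `a` or `b` lie in the K₄, by the neighbourhood hypotheses;
      -- `true` stands for red.
      { col = λ y z → if does (touch? y ⊎-dec touch? z) then does (red? y z) else col κ y z
      ; col-sym = λ y z → trans
          (cong₂ (λ s t → if s then t else col κ y z)
            (does-⇔ (mk⇔ (λ { (inj₁ h) → inj₂ h ; (inj₂ h) → inj₁ h }) (λ { (inj₁ h) → inj₂ h ; (inj₂ h) → inj₁ h }))
                    (touch? y ⊎-dec touch? z) (touch? z ⊎-dec touch? y))
            (does-⇔ (mk⇔ Red-sym Red-sym) (red? y z) (red? z y)))
          (cong (if does (touch? z ⊎-dec touch? y) then does (red? z y) else_) (col-sym κ y z))
      }
    near : ∀ {y z} → Touch y → col κ′ y z ≡ does (red? y z)
    near {y} {z} t rewrite dec-true (touch? y ⊎-dec touch? z) (inj₁ t) = refl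
    far : ∀ {y z} → ¬ Touch y → ¬ Touch z → col κ′ y z ≡ col κ y z
    far {y} {z} s t rewrite dec-false (touch? y ⊎-dec touch? z) (λ { (inj₁ h) → s h ; (inj₂ h) → t h }) = refl

    module _ {col′} (C : Core (Class G κ′ col′)) where
      open Core C
      Inactive : Fin (n G) → Set
      Inactive y = ∀ {z} → ¬ (y ∼ z)
      leaf : ∀ {y} p → (∀ {z} → y ∼ z → z ≡ p) → Inactive y
      leaf p only h with branch h
      ... | z , ne , k = ne (trans (only k) (sym (only h)))
      avoids : (∀ {y} → Touch y → Inactive y) → MonoCycle (delete-edge G x a) κ
      avoids inactive = core⇒mono col′ record
        { _∼_ = _∼_ ; ∼-sym = ∼-sym ; edge = edge ; branch = branch
        -- The deleted edge `xa` does not occur, because `x` is inactive.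
        ; ∼⇒R = λ h → let (adj , e) = ∼⇒R h ; s = λ t → inactive t h ; t = λ t → inactive t (∼-sym h) in
            (adj , λ { (inj₁ (p , _)) → s (inj₁ p) ; (inj₂ (p , _)) → s (inj₂ (inj₁ p)) }) , trans (sym (far s t)) e
        }

    does-yes : ∀ {P : Set} (d : Dec P) → does d ≡ true → P
    does-yes (yes p) _ = p
    does-no : ∀ {P : Set} (d : Dec P) → does d ≡ false → ¬ P
    does-no (no np) _ = np

    red-case : Core (Class G κ′ true) → MonoCycle (delete-edge G x a) κ
    red-case C = avoids C λ { (inj₁ refl) → x-out ; (inj₂ (inj₁ refl)) → a-out ; (inj₂ (inj₂ refl)) → b-out }
      where
      open Core C
      red : ∀ {y z} → Touch y → y ∼ z → Red y z
      red t h = does-yes (red? _ _) (trans (sym (near t)) (proj₂ (∼⇒R h)))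
      -- Red leaves are peeled off in the order `x`, `a`, `b`.
      x-out : Inactive C x
      x-out = leaf C a λ h → only (red (inj₁ refl) h)
        where
        only : ∀ {z} → Red x z → z ≡ a
        only (inj₁ (inj₁ (_ , e)))        = e
        only (inj₁ (inj₂ (e , _)))        = ⊥-elim (x≢a e)
        only (inj₂ (inj₁ (inj₁ (e , _)))) = ⊥-elim (x≢a e)
        only (inj₂ (inj₁ (inj₂ (e , _)))) = ⊥-elim (x≢b e)
        only (inj₂ (inj₂ (inj₁ (e , _)))) = ⊥-elim (x≢b e)
        only (inj₂ (inj₂ (inj₂ (e , _)))) = ⊥-elim (x≢c e)
      a-out : Inactive C a
      a-out = leaf C b λ h → only h (red (inj₂ (inj₁ refl)) h)
        where
        only : ∀ {z} → a ∼ z → Red a z → z ≡ b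
        only h (inj₁ (inj₁ (e , _)))        = ⊥-elim (x≢a (sym e))
        only h (inj₁ (inj₂ (_ , refl)))     = ⊥-elim (x-out (∼-sym h))
        only h (inj₂ (inj₁ (inj₁ (_ , e)))) = e
        only h (inj₂ (inj₁ (inj₂ (e , _)))) = ⊥-elim (a≢b e)
        only h (inj₂ (inj₂ (inj₁ (e , _)))) = ⊥-elim (a≢b e)
        only h (inj₂ (inj₂ (inj₂ (e , _)))) = ⊥-elim (a≢c e)
      b-out : Inactive C b
      b-out = leaf C c λ h → only h (red (inj₂ (inj₂ refl)) h)
        where
        only : ∀ {z} → b ∼ z → Red b z → z ≡ c
        only h (inj₁ (inj₁ (e , _)))           = ⊥-elim (x≢b (sym e))
        only h (inj₁ (inj₂ (e , _)))           = ⊥-elim (a≢b (sym e))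
        only h (inj₂ (inj₁ (inj₁ (e , _))))    = ⊥-elim (a≢b (sym e))
        only h (inj₂ (inj₁ (inj₂ (_ , refl)))) = ⊥-elim (a-out (∼-sym h))
        only h (inj₂ (inj₂ (inj₁ (_ , e))))    = e
        only h (inj₂ (inj₂ (inj₂ (e , _))))    = ⊥-elim (b≢c e)

    blue-case : Core (Class G κ′ false) → MonoCycle (delete-edge G x a) κ
    blue-case C = avoids C λ { (inj₁ refl) → x-out ; (inj₂ (inj₁ refl)) → a-out ; (inj₂ (inj₂ refl)) → b-out }
      where
      open Core C
      not-red : ∀ {y z} → Touch y → y ∼ z → ¬ Red y z
      not-red t h = does-no (red? _ _) (trans (sym (near t)) (proj₂ (∼⇒R h)))
      -- Blue leaves are peeled off as `b`, then `x`; at the other end of the path `a` hangs on `c`.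
      b-out : Inactive C b
      b-out = leaf C x λ h → only h (Nb (proj₁ (∼⇒R h)))
        where
        only : ∀ {z} → b ∼ z → z ≡ x ⊎ z ≡ a ⊎ z ≡ c → z ≡ x
        only h (inj₁ e)           = e
        only h (inj₂ (inj₁ refl)) = ⊥-elim (not-red (inj₂ (inj₂ refl)) h (inj₂ (inj₁ (inj₂ (refl , refl)))))
        only h (inj₂ (inj₂ refl)) = ⊥-elim (not-red (inj₂ (inj₂ refl)) h (inj₂ (inj₂ (inj₁ (refl , refl)))))
      x-out : Inactive C x
      x-out = leaf C c λ h → only h (Nx (proj₁ (∼⇒R h)))
        where
        only : ∀ {z} → x ∼ z → z ≡ a ⊎ z ≡ b ⊎ z ≡ c → z ≡ c
        only h (inj₁ refl)        = ⊥-elim (not-red (inj₁ refl) h (inj₁ (inj₁ (refl , refl))))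
        only h (inj₂ (inj₁ refl)) = ⊥-elim (b-out (∼-sym h))
        only h (inj₂ (inj₂ e))    = e
      a-out : Inactive C a
      a-out = leaf C c λ h → only h (Na (proj₁ (∼⇒R h)))
        where
        only : ∀ {z} → a ∼ z → z ≡ x ⊎ z ≡ b ⊎ z ≡ c → z ≡ c
        only h (inj₁ refl)        = ⊥-elim (x-out (∼-sym h))
        only h (inj₂ (inj₁ refl)) = ⊥-elim (b-out (∼-sym h))
        only h (inj₂ (inj₂ e))    = e

    restrict : (∃ λ col′ → ∃ (EvenIn (Class G κ′ col′))) → MonoCycle (delete-edge G x a) κ
    restrict (true  , E , ev) = red-case (even⇒core ev)
    restrict (false , E , ev) = blue-case (even⇒core ev)

module _ {G : Graph} (min : Minimal G)
  (two : ∀ {u v} → Adj G u v → ¬ AtMostOneTriangle G u v)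
  (no-K5-e : ¬ K5-e ⊆ G) (no-K4∨K4 : ¬ K4∨K4 ⊆ G) where

  Common : (u v : Fin (n G)) → Fin (n G) → Set
  Common u v w = Adj G u w × Adj G v w

  two-triangles : ∀ {u v} → Adj G u v → ∃ λ w → ∃ λ w′ → w ≢ w′ × Common u v w × Common u v w′
  two-triangles {u} {v} uv with any? (λ w → any? λ w′ → ¬? (w ≟ w′) ×-dec
      (adj? G u w ×-dec adj? G v w) ×-dec (adj? G u w′ ×-dec adj? G v w′))
  ... | yes found = found
  ... | no none = ⊥-elim (two uv λ w w′ a b a′ b′ → decidable-stable (w ≟ w′) λ ne →
                    none (w , w′ , ne , (a , b) , a′ , b′))

  private
    ~ : Symm (Adj G)
    ~ = adj-sym G
    ne : ∀ {x y} → Adj G x y → x ≢ y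
    ne = adj-≢ G

  -- Vertices of degree three and their K₄'s

  Cubic : Fin (n G) → Set
  Cubic x = deg G x ≡ 3

  cubic? : ∀ x → Dec (Cubic x)
  cubic? x = deg G x ℕ.≟ 3

  neighbours : ∀ {x a b c} → Cubic x → Adj G x a → Adj G x b → Adj G x c → a ≢ b → a ≢ c → b ≢ c →
               ∀ {y} → Adj G x y → y ≡ a ⊎ y ≡ b ⊎ y ≡ c
  neighbours {x} {a} {b} {c} x3 xa xb xc a≢b a≢c b≢c {y} xy with y ≟ a | y ≟ b | y ≟ c
  ... | yes e | _ | _ = inj₁ e
  ... | _ | yes e | _ = inj₂ (inj₁ e)
  ... | _ | _ | yes e = inj₂ (inj₂ e)
  ... | no y≢a | no y≢b | no y≢c = ⊥-elim (ℕ.1+n≰n (subst (4 ≤_) x3 (count-≥ (adj? G x)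
      {y ∷ a ∷ b ∷ c ∷ []} ((y≢a ∷ y≢b ∷ y≢c ∷ []) ∷ (a≢b ∷ a≢c ∷ []) ∷ (b≢c ∷ []) ∷ [] ∷ []) (xy ∷ xa ∷ xb ∷ xc ∷ []))))

  -- The triangles on `xv` show that `v`, `w`, `w′` are all the neighbours of `x`. The two triangles
  -- on `xw` have apexes among `v` and `w′`, hence use both, and `ww′` is an edge.
  cubic-K4 : ∀ {x v} → Cubic x → Adj G x v → ∃ λ b → ∃ λ c → K4 G x v b c
  cubic-K4 {x} {v} x3 xv with two-triangles xv
  ... | w , w′ , w≢w′ , (xw , vw) , (xw′ , vw′) = w , w′ , k4 xv xw xw′ vw vw′ (ww′ (two-triangles xw))
    where
    N : ∀ {y} → Adj G x y → y ≡ v ⊎ y ≡ w ⊎ y ≡ w′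
    N = neighbours x3 xv xw xw′ (ne vw) (ne vw′) w≢w′
    ww′ : (∃ λ p → ∃ λ p′ → p ≢ p′ × Common x w p × Common x w p′) → Adj G w w′
    ww′ (p , p′ , p≢p′ , (xp , wp) , (xp′ , wp′)) with N xp | N xp′
    ... | inj₂ (inj₂ refl) | _ = wp
    ... | _ | inj₂ (inj₂ refl) = wp′
    ... | inj₂ (inj₁ e) | _ = ⊥-elim (ne wp (sym e))
    ... | _ | inj₂ (inj₁ e) = ⊥-elim (ne wp′ (sym e))
    ... | inj₁ e | inj₁ e′ = ⊥-elim (p≢p′ (trans e (sym e′)))

  K4-neighbours : ∀ {x a b c} → K4 G x a b c → Cubic x → ∀ {y} → Adj G x y → y ≡ a ⊎ y ≡ b ⊎ y ≡ c
  K4-neighbours (k4 xa xb xc ab ac bc) x3 = neighbours x3 xa xb xc (ne ab) (ne ac) (ne bc)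

  not-three-cubic : ∀ {x a b c} → K4 G x a b c → Cubic x → Cubic a → Cubic b → ⊥
  not-three-cubic k@(k4 xa xb xc ab ac bc) x3 a3 b3 = no-pendant-K4 min k (K4-neighbours k x3)
    (neighbours a3 (~ xa) ab ac (ne xb) (ne xc) (ne bc)) (neighbours b3 (~ xb) (~ ab) bc (ne xa) (ne xc) (ne ac))

  deg-≥3 : ∀ x → 3 ≤ deg G x
  deg-≥3 x with no-isolated min x
  ... | y , xy with two-triangles xy
  ...   | w , w′ , w≢w′ , (xw , yw) , (xw′ , yw′) = count-≥ (adj? G x) {y ∷ w ∷ w′ ∷ []}
            ((ne yw ∷ ne yw′ ∷ []) ∷ (w≢w′ ∷ []) ∷ [] ∷ []) (xy ∷ xw ∷ xw′ ∷ [])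

  cubicNeighbour? : ∀ v w → Dec (Adj G v w × Cubic w)
  cubicNeighbour? v w = adj? G v w ×-dec cubic? w

  cubic-neighbours : Fin (n G) → ℕ
  cubic-neighbours v = count (cubicNeighbour? v)

  no-cubic-neighbour : ∀ {v} → (∀ w → ¬ (Adj G v w × Cubic w)) → cubic-neighbours v ≤ 0
  no-cubic-neighbour {v} none = count-≤ (cubicNeighbour? v) [] λ y p _ → none y p

  -- All neighbours of `v` lie in one K₄, which besides `v` has room for only one more cubic vertex.
  cubic-bound : ∀ {v} → Cubic v → cubic-neighbours v ≤ 1
  cubic-bound {v} v3 with any? (cubicNeighbour? v)
  ... | no none = ℕ.≤-trans (no-cubic-neighbour λ w p → none (w , p)) z≤n
  ... | yes (x , vx , x3) with cubic-K4 v3 vx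
  ...   | b , c , k = count-≤ (cubicNeighbour? v) (x ∷ []) unique
    where
    unique : ∀ y → Adj G v y × Cubic y → ¬ All (y ≢_) (x ∷ [])
    unique y (vy , y3) (y≢x ∷ []) with K4-neighbours k v3 vy
    ... | inj₁ e           = y≢x e
    ... | inj₂ (inj₁ refl) = not-three-cubic k v3 x3 y3
    ... | inj₂ (inj₂ refl) = not-three-cubic (swap k) v3 x3 y3

  -- With `x` cubic, `b` and `c` cannot both be; the naming makes `c` a noncubic neighbour of `v`
  -- for the later count.
  noncubic-K4 : ∀ {x v} → Cubic x → Adj G x v → ∃ λ b → ∃ λ c → K4 G x v b c × ¬ Cubic c
  noncubic-K4 {x} {v} x3 xv with cubic-K4 x3 xv
  ... | b , c , k with cubic? c | cubic? b
  ...   | no c≢3 | _      = b , c , k , c≢3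
  ...   | yes _  | no b≢3 = c , b , swap k , b≢3
  ...   | yes c3 | yes b3 = ⊥-elim (not-three-cubic (turn k) x3 b3 c3)

  module _ {v x b c} (k : K4 G x v b c) (x3 : Cubic x) where
    open K4 k renaming (pq to xv; pr to xb; ps to xc; qr to vb; qs to vc; rs to bc)

    apart : ∀ {y} → y ≢ v → y ≢ b → y ≢ c → ¬ Adj G x y
    apart y≢v y≢b y≢c xy with K4-neighbours k x3 xy
    ... | inj₁ e        = y≢v e
    ... | inj₂ (inj₁ e) = y≢b e
    ... | inj₂ (inj₂ e) = y≢c e

    -- The two K₄'s would share the edge `vb`. If they share `c` too, they contain K₅ - e with `x`,
    -- `y` as the missing edge; otherwise they form K₄ ∨ K₄.
    no-clash : ∀ {y p} → y ≢ x → y ≢ b → y ≢ c → K4 G y v b p → ⊥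
    no-clash {y} {p} y≢x y≢b y≢c (k4 yv yb yp _ vp bp) with p ≟ c
    ... | yes refl = no-K5-e (K5-e-⊆ (rotate k) yv yb yp y≢x)
    ... | no p≢c = no-K4∨K4 (K4∨K4-⊆ (rotate k) (k4 vb vp (~ yv) bp (~ yb) (~ yp))
                     (p≢c ∘ sym) (y≢c ∘ sym) x≢p (y≢x ∘ sym))
      where
      x≢p : x ≢ p
      x≢p refl = apart (ne yv) y≢b y≢c (~ yp)

    -- At degree four, let `y` be the fourth neighbour. As `x` is not adjacent to `y`, the two
    -- triangles on `vy` have apexes `b` and `c`, and K₅ - e appears on `v`, `b`, `c`, `x`, `y`.
    deg-≥5 : ¬ Cubic v → 5 ≤ deg G v
    deg-≥5 v≢3 = ℕ.≤∧≢⇒< deg-≥4 (deg≢4 ∘ sym)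
      where
      deg-≥4 : 4 ≤ deg G v
      deg-≥4 = ℕ.≤∧≢⇒< (deg-≥3 v) (v≢3 ∘ sym)
      deg≢4 : deg G v ≢ 4
      deg≢4 v4 with count-witness (adj? G v) (x ∷ b ∷ c ∷ []) deg-≥4
      ... | y , vy , y≢x ∷ y≢b ∷ y≢c ∷ [] with two-triangles vy
      ...   | w , w′ , w≢w′ , p , p′ = finish (b-or-c p) (b-or-c p′)
        where
        b-or-c : ∀ {w} → Common v y w → (w ≡ b × Adj G y b) ⊎ (w ≡ c × Adj G y c)
        b-or-c {w} (vw , yw) with w ≟ b | w ≟ c | w ≟ x
        ... | yes refl | _ | _ = inj₁ (refl , yw)
        ... | _ | yes refl | _ = inj₂ (refl , yw)
        ... | _ | _ | yes refl = ⊥-elim (apart (ne (~ vy)) y≢b y≢c (~ yw))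
        ... | no w≢b | no w≢c | no w≢x = ⊥-elim (ℕ.1+n≰n (subst (5 ≤_) v4 (count-≥ (adj? G v)
              {w ∷ y ∷ x ∷ b ∷ c ∷ []}
              ((ne (~ yw) ∷ w≢x ∷ w≢b ∷ w≢c ∷ []) ∷ (y≢x ∷ y≢b ∷ y≢c ∷ []) ∷ (ne xb ∷ ne xc ∷ []) ∷ (ne bc ∷ []) ∷ [] ∷ [])
              (vw ∷ vy ∷ ~ xv ∷ vb ∷ vc ∷ []))))
        K5 : Adj G y b → Adj G y c → ⊥
        K5 yb yc = no-K5-e (K5-e-⊆ (rotate k) (~ vy) yb yc y≢x)
        finish : (w ≡ b × Adj G y b) ⊎ (w ≡ c × Adj G y c) → (w′ ≡ b × Adj G y b) ⊎ (w′ ≡ c × Adj G y c) → ⊥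
        finish (inj₁ (_ , yb)) (inj₂ (_ , yc)) = K5 yb yc
        finish (inj₂ (_ , yc)) (inj₁ (_ , yb)) = K5 yb yc
        finish (inj₁ (e , _)) (inj₁ (e′ , _))  = w≢w′ (trans e (sym e′))
        finish (inj₂ (e , _)) (inj₂ (e′ , _))  = w≢w′ (trans e (sym e′))

  -- Three cases: no cubic neighbour, all of them in one K₄ through `v`, or two K₄'s meeting only in
  -- `v`. The degree is then at least 4, 5 and 6 respectively.
  noncubic-bound : ∀ {v} → ¬ Cubic v → cubic-neighbours v + 8 ≤ deg G v + deg G v
  noncubic-bound {v} v≢3 with any? (cubicNeighbour? v)
  ... | no none = ℕ.≤-trans (ℕ.+-monoˡ-≤ 8 (no-cubic-neighbour λ w p → none (w , p)))
                            (ℕ.+-mono-≤ deg-≥4 deg-≥4)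
    where
    deg-≥4 : 4 ≤ deg G v
    deg-≥4 = ℕ.≤∧≢⇒< (deg-≥3 v) (v≢3 ∘ sym)
  ... | yes (x , vx , x3) with noncubic-K4 x3 (~ vx)
  ...   | b , c , k , c≢3 with any? (λ y → cubicNeighbour? v y ×-dec ¬? (y ≟ x) ×-dec ¬? (y ≟ b) ×-dec ¬? (y ≟ c))
  -- Only `x` and `b` can be cubic, so the bound follows from 2 + 8 ≤ 5 + 5.
  ...     | no none = ℕ.≤-trans (ℕ.+-monoˡ-≤ 8 (count-≤ (cubicNeighbour? v) (x ∷ b ∷ []) only))
                                (ℕ.+-mono-≤ (deg-≥5 k x3 v≢3) (deg-≥5 k x3 v≢3))
    where
    only : ∀ y → Adj G v y × Cubic y → ¬ All (y ≢_) (x ∷ b ∷ [])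
    only y p (y≢x ∷ y≢b ∷ []) = none (y , p , y≢x , y≢b , λ { refl → c≢3 (proj₂ p) })
  ...     | yes (y , (vy , y3) , y≢x , y≢b , y≢c) with noncubic-K4 y3 (~ vy)
  ...       | b′ , c′ , k′ , c′≢3 = begin
      -- The 8 splits as 2 + 6: the noncubic neighbours `c`, `c′` account for the 2, and the six
      -- vertices other than `v` in the two K₄'s for the 6.
      cubic-neighbours v + 8       ≡⟨ ℕ.+-assoc (cubic-neighbours v) 2 6 ⟨
      cubic-neighbours v + 2 + 6   ≤⟨ ℕ.+-mono-≤ two-noncubic six ⟩
      deg G v + deg G v            ∎
    where
    open ℕ.≤-Reasoning
    open K4 k renaming (pq to xv; pr to xb; ps to xc; qr to vb; qs to vc; rs to bc)
    open K4 k′ renaming (pq to yv; pr to yb′; ps to yc′; qr to vb′; qs to vc′; rs to b′c′)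
    -- The second K₄ avoids `x` by `apart`, and `b` and `c` by `no-clash`.
    new : ∀ {p p′} → K4 G y v p p′ → p ≢ x × p ≢ b × p ≢ c
    new l@(k4 yv yp _ _ _ _) = (λ { refl → apart k x3 (ne yv) y≢b y≢c (~ yp) })
      , (λ { refl → no-clash k x3 y≢x y≢b y≢c l })
      , (λ { refl → no-clash (swap k) x3 y≢x y≢c y≢b l })
    two-noncubic : cubic-neighbours v + 2 ≤ deg G v
    two-noncubic = ℕ.≤-trans
      (ℕ.+-monoʳ-≤ (cubic-neighbours v) (count-≥ rest? {c ∷ c′ ∷ []}
        (((proj₂ (proj₂ (new (swap k′))) ∘ sym) ∷ []) ∷ [] ∷ []) ((vc , c≢3) ∷ (vc′ , c′≢3) ∷ [])))
      (count-pack (cubicNeighbour? v) rest? (adj? G v) (λ _ → proj₁) (λ _ → proj₁) λ { w (_ , w3) (_ , w≢3) → w≢3 w3 })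
      where
      rest? : ∀ w → Dec (Adj G v w × ¬ Cubic w)
      rest? w = adj? G v w ×-dec ¬? (cubic? w)
    six : 6 ≤ deg G v
    six = let (b′x , b′b , b′c) = new k′ ; (c′x , c′b , c′c) = new (swap k′) in
      count-≥ (adj? G v) {b′ ∷ c′ ∷ y ∷ x ∷ b ∷ c ∷ []}
        ((ne b′c′ ∷ ne (~ yb′) ∷ b′x ∷ b′b ∷ b′c ∷ []) ∷ (ne (~ yc′) ∷ c′x ∷ c′b ∷ c′c ∷ []) ∷
         (y≢x ∷ y≢b ∷ y≢c ∷ []) ∷ (ne xb ∷ ne xc ∷ []) ∷ (ne bc ∷ []) ∷ [] ∷ [])
        (vb′ ∷ vc′ ∷ vy ∷ ~ xv ∷ vb ∷ vc ∷ [])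

  -- A discharging inequality: for cubic `v` it comes from 1 + 8 ≤ 3 + 3 + 3, and the extra 3 is
  -- recovered on summation by `cubic-incidences`.
  local-bound : ∀ v → cubic-neighbours v + 8 ≤ deg G v + deg G v + ⟦ cubic? v ⟧ * 3
  local-bound v = by-cases (cubic? v)
    where
    by-cases : (d : Dec (Cubic v)) → cubic-neighbours v + 8 ≤ deg G v + deg G v + ⟦ d ⟧ * 3
    by-cases (yes v3) = subst (λ d → cubic-neighbours v + 8 ≤ d + d + 3) (sym v3) (ℕ.+-monoˡ-≤ 8 (cubic-bound v3))
    by-cases (no v≢3) = ℕ.≤-trans (noncubic-bound v≢3) (ℕ.m≤m+n _ 0)

  -- Double counting: a cubic vertex is counted by each of its three neighbours.
  cubic-incidences : ∑.sum (λ w → ⟦ cubic? w ⟧ * 3) ≤ ∑.sum cubic-neighbours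
  cubic-incidences = ℕ.≤-trans (∑-mono λ w → incident w (cubic? w))
    (ℕ.≤-reflexive (sym (∑.∑-comm (λ v w → ⟦ cubicNeighbour? v w ⟧))))
    where
    incident : ∀ w (d : Dec (Cubic w)) → ⟦ d ⟧ * 3 ≤ count (λ v → cubicNeighbour? v w)
    incident w (no _)  = z≤n
    incident w (yes w3) = subst (_≤ count (λ v → cubicNeighbour? v w)) w3
      (count-mono (adj? G w) (λ v → cubicNeighbour? v w) λ v wv → ~ wv , w3)

  dense : double (double (n G)) ≤ degree-sum G
  dense = halve (ℕ.+-cancelˡ-≤ (∑.sum cubic-neighbours) _ _ (begin
    ∑.sum cubic-neighbours + double (double (double (n G)))
      ≡⟨ cong (∑.sum cubic-neighbours +_) (trans (octuple (n G)) (sym (∑-const (n G) 8))) ⟩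
    ∑.sum cubic-neighbours + ∑.sum {n G} (λ _ → 8)   ≡⟨ ∑.∑-distrib-+ cubic-neighbours (λ _ → 8) ⟨
    ∑.sum (λ v → cubic-neighbours v + 8)             ≤⟨ ∑-mono local-bound ⟩
    ∑.sum (λ v → deg G v + deg G v + ⟦ cubic? v ⟧ * 3)
      ≡⟨ ∑.∑-distrib-+ (λ v → deg G v + deg G v) (λ v → ⟦ cubic? v ⟧ * 3) ⟩
    ∑.sum (λ v → deg G v + deg G v) + ∑.sum (λ v → ⟦ cubic? v ⟧ * 3)
      ≤⟨ ℕ.+-mono-≤ (ℕ.≤-reflexive (∑.∑-distrib-+ (deg G) (deg G))) cubic-incidences ⟩
    double (degree-sum G) + ∑.sum cubic-neighbours   ≡⟨ ℕ.+-comm (double (degree-sum G)) _ ⟩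
    ∑.sum cubic-neighbours + double (degree-sum G)   ∎))
    where
    open ℕ.≤-Reasoning
    octuple : ∀ k → double (double (double k)) ≡ k * 8
    octuple = solve 1 (λ k → ((k :+ k) :+ (k :+ k)) :+ ((k :+ k) :+ (k :+ k)) := k :* con 8) refl
      where open +-*-Solver
    halve : ∀ {k l} → double k ≤ double l → k ≤ l
    halve le = ℕ.≮⇒≥ λ lt → ℕ.<⇒≱ (ℕ.+-mono-< lt lt) le

-- Base graphs and reducible edges

K5-e-ramsey : Ramsey K5-e
-- The edge bound is attained: 4 · 5 = 2 + 2 · 9.
K5-e-ramsey = many-edges⇒ramsey K5-e (s≤s z≤n) ℕ.≤-refl

K4∨K4-ramsey : Ramsey K4∨K4
-- Again with equality: 4 · 6 = 2 + 2 · 11.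
K4∨K4-ramsey = many-edges⇒ramsey K4∨K4 (s≤s z≤n) ℕ.≤-refl

-- A base graph inside `G` is all of `G` by `minimal-iso`. With neither a base graph nor a reducible
-- edge, `dense` contradicts `minimal-sparse`.
base-or-reducible : ∀ {G} → Minimal G →
  Base G ⊎ (∃ λ u → ∃ λ v → Adj G u v × AtMostOneTriangle G u v)
base-or-reducible {G} min = by-cases (K5-e ⊆? G) (K4∨K4 ⊆? G) (any? λ u → any? λ v → reducible? u v)
  where
  reducible? : ∀ u v → Dec (Adj G u v × AtMostOneTriangle G u v)
  reducible? u v = adj? G u v ×-dec all? λ w → all? λ w′ →
    adj? G u w →-dec adj? G v w →-dec adj? G u w′ →-dec adj? G v w′ →-dec (w ≟ w′)
  by-cases : Dec (K5-e ⊆ G) → Dec (K4∨K4 ⊆ G) → Dec (∃ λ u → ∃ λ v → Adj G u v × AtMostOneTriangle G u v) →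
             Base G ⊎ (∃ λ u → ∃ λ v → Adj G u v × AtMostOneTriangle G u v)
  by-cases (yes f) _       _       = inj₁ (inj₁ (minimal-iso min K5-e-ramsey f))
  by-cases (no _)  (yes g) _       = inj₁ (inj₂ (minimal-iso min K4∨K4-ramsey g))
  by-cases (no _)  (no _)  (yes r) = inj₂ r
  by-cases (no ¬f) (no ¬g) (no ¬r) = ⊥-elim (ℕ.<⇒≱ (minimal-sparse min)
    (dense min (λ uv few → ¬r (_ , _ , uv , few)) ¬f ¬g))

-- Minor chains

snoc : ∀ {k} → (Fin k → Graph) → Graph → Fin (suc k) → Graph
snoc {zero}  Gs G _       = G
snoc {suc k} Gs G zero    = Gs zero
snoc {suc k} Gs G (suc i) = snoc (Gs ∘ suc) G i

snoc-fromℕ : ∀ {k} (Gs : Fin k → Graph) G → snoc Gs G (fromℕ k) ≡ G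
snoc-fromℕ {zero}  Gs G = refl
snoc-fromℕ {suc k} Gs G = snoc-fromℕ (Gs ∘ suc) G

snoc-minimal : ∀ {k} (Gs : Fin k → Graph) {G} → (∀ i → Minimal (Gs i)) → Minimal G → ∀ i → Minimal (snoc Gs G i)
snoc-minimal {zero}  Gs h g _       = g
snoc-minimal {suc k} Gs h g zero    = h zero
snoc-minimal {suc k} Gs h g (suc i) = snoc-minimal (Gs ∘ suc) (h ∘ suc) g i

snoc-steps : ∀ {k} (Gs : Fin (suc k) → Graph) G → (∀ i → Minor (Gs (inject₁ i)) (Gs (suc i))) →
             Minor (Gs (fromℕ k)) G → ∀ i → Minor (snoc Gs G (inject₁ i)) (snoc Gs G (suc i))
snoc-steps {zero}  Gs G h last zero    = last
snoc-steps {suc k} Gs G h last zero    = h zero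
snoc-steps {suc k} Gs G h last (suc i) = snoc-steps (Gs ∘ suc) G (h ∘ suc) last i

extend-chain : ∀ {H G} → MinorChain H → Minimal G → Minor H G → MinorChain G
extend-chain {H} {G} (len , Gs , mins , base , last , minors) min minor =
  suc len , snoc Gs G , snoc-minimal Gs mins min , base , snoc-fromℕ Gs G ,
  snoc-steps Gs G minors (subst (λ K → Minor K G) (sym last) minor)

⊆-size : ∀ {H G} → H ⊆ G → n H ≤ n G
⊆-size f = injective⇒≤ (_⊆_.inj f)

smaller : ∀ G {H k u v} (e : Adj G u v) → H ⊆ contract G u v e → n G ≤ suc k → n H ≤ k
smaller G {u = u} {v} e f le = s≤s⁻¹ (ℕ.≤-trans (s≤s (⊆-size f)) (subst (_≤ _) (sym (contract-size G u v e)) le))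

no-vertices : ∀ G → Ramsey G → n G ≤ 0 → ∀ {A : Set₁} → A
no-vertices record { n = zero } RG le with some-vertex RG
... | ()

-- Induction on a bound for the number of vertices, which contraction lowers by one.
chain : ∀ k G → n G ≤ k → Minimal G → MinorChain G
chain zero    G le min = no-vertices G (proj₁ min) le
chain (suc k) G le min = case base-or-reducible min of λ where
  (inj₁ base) → 0 , (λ _ → G) , (λ _ → min) , base , refl , λ ()
  (inj₂ (u , v , e , few)) →
    let (H , f , minH) = minimal-subgraph (contract-ramsey G (proj₁ min) u v e few)
    in extend-chain (chain k H (smaller G e f le) minH) min (con u v e (sub f))

-- The same descent serves all choices: `contract-ramsey` covers each edge in at most one triangle,
-- and any `H` inside the contraction has fewer vertices than `G`.
greedy : ∀ k G → n G ≤ k → Minimal G → Greedy G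
greedy zero    G le min = no-vertices G (proj₁ min) le
greedy (suc k) G le min = case base-or-reducible min of λ where
  (inj₁ base)      → done base
  (inj₂ reducible) → step reducible λ u v e few → contract-ramsey G (proj₁ min) u v e few ,
    λ H minH f → greedy k H (smaller G e f le) minH

theorem1p3 : ∀ (G : Graph) → Minimal G → MinorChain G × Greedy G
theorem1p3 G min = chain (n G) G ℕ.≤-refl min , greedy (n G) G ℕ.≤-refl min
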